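{- For every integer $k\ge 4$ there exist $\varepsilon>0$ and $n_0\in\mathbb{N}$ such that for all $n>n_0$ there exists a pair of $k$-ary structures $\mathcal{A},\mathcal{B}$ over a common signature with $|A|=|B|=n$ such that some sentence of $\exists^{+}\mathcal{L}^k$ distinguishes $\mathcal{A}$ from $\mathcal{B}$, but $\mathcal{A}$ and $\mathcal{B}$ agree on every sentence of $\exists^{+}\mathcal{L}^k$ with fewer than $2^{\varepsilon n^{2k-4}}$ quantifiers.
   Context: All structures are finite and relational, with a finite signature (the signature is not fixed in advance and may depend on $n$). A $k$-ary structure is a structure all of whose relations have arity at most $k$. $A$ and $B$ denote the domains of $\mathcal{A}$ and $\mathcal{B}$. $\mathcal{L}^k$ is the set of first-order formulas (with equality) using only the variables $x_1,\dots,x_k$ (variables may be requantified). $\exists^{+}\mathcal{L}^k$ is its existential-positive fragment: formulas of $\mathcal{L}^k$ built from atomic formulas (including equalities) using only $\wedge,\vee,\exists$ (no $\neg$, no $\forall$). The number of quantifiers of a formula is the total number of occurrences of quantifiers in it. Two structures agree on a sentence if both satisfy it or neither does; a sentence distinguishes two structures if they do not agree on it. -}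

module Defs where

open import Data.Bool using (Bool; T)
open import Data.Fin using (Fin)
open import Data.Integer using (∣_∣)
open import Data.Nat using (ℕ; _+_; _*_; _^_; _≤_; _<_)
open import Data.Product using (_×_; ∃)
open import Data.Rational using (ℚ; ↥_; ↧ₙ_)
open import Data.Sum using (_⊎_)
open import Data.Vec using (Vec; lookup; map; _[_]≔_)
open import Data.Vec.Membership.Propositional using (_∈_)
open import Function using (_⇔_)
open import Relation.Binary.PropositionalEquality using (_≡_; _≢_)
open import Relation.Nullary using (¬_)

record Signature : Set where
  field
    #relations : ℕ
    arity      : Fin #relations → ℕ

  Relation : Set
  Relation = Fin #relations

open Signature public

_-ary : ℕ → Signature → Set
(k -ary) σ = ∀ (R : Relation σ) → arity σ R ≤ k

-- Structures of cardinality n; up to isomorphism their domain is Fin n.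
-- Relations are Bool-valued so that, as in classical finite model theory,
-- every atomic fact either holds or fails.
record Structure (σ : Signature) (n : ℕ) : Set where
  field
    interp : (R : Relation σ) → Vec (Fin n) (arity σ R) → Bool

open Structure public

infix  8 _≐_
infixr 7 _∧_
infixr 6 _∨_

-- The existential-positive fragment of k-variable first-order logic.
-- Variables are named, not de Bruijn indices, so they can be requantified.
data ∃⁺L (σ : Signature) (k : ℕ) : Set where
  rel     : (R : Relation σ) → Vec (Fin k) (arity σ R) → ∃⁺L σ k
  _≐_     : Fin k → Fin k → ∃⁺L σ k
  _∧_ _∨_ : ∃⁺L σ k → ∃⁺L σ k → ∃⁺L σ k
  ex      : Fin k → ∃⁺L σ k → ∃⁺L σ k

module _ {σ : Signature} {k : ℕ} where

  #quantifiers : ∃⁺L σ k → ℕ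
  #quantifiers (rel R xs) = 0
  #quantifiers (x ≐ y)    = 0
  #quantifiers (φ ∧ ψ)    = #quantifiers φ + #quantifiers ψ
  #quantifiers (φ ∨ ψ)    = #quantifiers φ + #quantifiers ψ
  #quantifiers (ex x φ)   = 1 + #quantifiers φ

  _FreeIn_ : Fin k → ∃⁺L σ k → Set
  z FreeIn rel R xs = z ∈ xs
  z FreeIn (x ≐ y)  = z ≡ x ⊎ z ≡ y
  z FreeIn (φ ∧ ψ)  = z FreeIn φ ⊎ z FreeIn ψ
  z FreeIn (φ ∨ ψ)  = z FreeIn φ ⊎ z FreeIn ψ
  z FreeIn (ex x φ) = z ≢ x × z FreeIn φ

  Sentence : ∃⁺L σ k → Set
  Sentence φ = ∀ z → ¬ (z FreeIn φ)

  _,_⊩_ : ∀ {n} → Structure σ n → Vec (Fin n) k → ∃⁺L σ k → Set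
  A , s ⊩ rel R xs = T (interp A R (map (lookup s) xs))
  A , s ⊩ (x ≐ y)  = lookup s x ≡ lookup s y
  A , s ⊩ (φ ∧ ψ)  = (A , s ⊩ φ) × (A , s ⊩ ψ)
  A , s ⊩ (φ ∨ ψ)  = (A , s ⊩ φ) ⊎ (A , s ⊩ ψ)
  A , s ⊩ ex x φ   = ∃ λ a → A , (s [ x ]≔ a) ⊩ φ

  -- For a sentence over a nonempty domain the choice of s is immaterial.
  _⊨_ : ∀ {n} → Structure σ n → ∃⁺L σ k → Set
  A ⊨ φ = ∀ s → A , s ⊩ φ

  AgreeOn : ∀ {n} → Structure σ n → Structure σ n → ∃⁺L σ k → Set
  AgreeOn A B φ = A ⊨ φ ⇔ B ⊨ φ

  Distinguishes : ∀ {n} → ∃⁺L σ k → Structure σ n → Structure σ n → Set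
  Distinguishes φ A B = ¬ AgreeOn A B φ

-- m < 2 ^ (ε · N) for a positive rational ε = p / q, with both sides raised
-- to the power q to stay within ℕ: m ^ q < 2 ^ (p · N).  Only meaningful for
-- ε > 0, because the sign of p is dropped.
_<2^[_·_] : ℕ → ℚ → ℕ → Set
m <2^[ ε · N ] = m ^ (↧ₙ ε) < 2 ^ (∣ ↥ ε ∣ * N)

{-# OPTIONS --safe #-}

-- Put d = k − 2.  Spoiler has to count from 0 to (Q + 1)^d − 1 in base Q + 1,
-- where Q = N² and N is proportional to n.  Each digit is stored in one
-- variable: the element of A on it contributes α and the answer in B
-- contributes β, so that linearly many elements suffice for N² nonzero
-- digits.  The other two variables D and P serve to advance the counter:
-- after ask, answered by some z, Spoiler obtains with permit (bit z) j α the
-- right to raise the digit j; he then resets the digits below j, and commit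
-- followed by digit j α stores the new digit.  The counter cannot be advanced
-- beyond its maximum, where ask has no answer.
--
-- Since ask can be answered with either bit and permit b j α is worth
-- something against one bit only, Spoiler's sentence has to contain a
-- continuation for both, and doubles in size with every step of the counter.
-- All rules of the game that could help him apply only when each of the k
-- variables holds an element of its own colour, so he cannot keep a copy of
-- any information.  The rules become structures by having one relation for
-- each k-tuple c of A, which holds in A at c and in B at the legal answers
-- to c.
module Submission where

open import Data.Bool using (T)
open import Data.Bool.Properties using (T?)
open import Data.Fin using (Fin; zero; suc; toℕ; fromℕ<; inject≤; punchOut; combine; remQuot; finToFun; funToFin)
import Data.Fin as Fin
open import Data.Fin.Properties using (_≟_; _<?_; all?; any?; ¬∀⟶∃¬; pigeonhole; toℕ<n; toℕ-injective; toℕ-fromℕ<; fromℕ<-toℕ; fromℕ<-cong; toℕ-inject≤; toℕ-combine; combine-injective; combine-remQuot; finToFun-funToFin; punchOut-injective; injective⇒≤; +↔⊎; *↔×; 1↔⊤)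
open import Data.Integer using (+_; +<+)
open import Data.List using (List; []; _∷_)
import Data.List as List
open import Data.List.Membership.Propositional using () renaming (_∈_ to _∈ˡ_; _∉_ to _∉ˡ_)
open import Data.List.Membership.Propositional.Properties using (∈-allFin)
open import Data.Maybe using (Maybe; just; nothing)
import Data.Maybe.Properties as Maybe
open import Data.Maybe.Properties using (just-injective)
open import Data.Nat using (ℕ; zero; suc; _+_; _*_; _∸_; _^_; _/_; _%_; _≤_; _<_; _≥_; _>_; z≤n; s≤s)
import Data.Nat as ℕ
open import Data.Nat.Coprimality using (1-coprimeTo)
open import Data.Nat.DivMod using (m/n*n≤m; /-mono-≤; m*n/n≡m; m≡m%n+[m/n]*n; m%n<n)
import Data.Nat.Properties as ℕ
open import Data.Nat.Tactic.RingSolver using (solve-∀)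
open import Data.Product using (_×_; _,_; proj₁; proj₂; uncurry; ∃₂; ∃-syntax; Σ-syntax)
import Data.Product as Product
open import Data.Product.Function.NonDependent.Propositional using (_×-↔_)
open import Data.Rational using (ℚ; 0ℚ; mkℚ; *<*) renaming (_>_ to _>ℚ_)
open import Data.Sum using (_⊎_; inj₁; inj₂)
import Data.Sum as Sum
open import Data.Sum.Function.Propositional using (_⊎-↔_)
open import Data.Unit using (⊤; tt)
open import Data.Vec using (Vec; []; _∷_; lookup; map; tabulate; replicate; allFin; _[_]≔_)
import Data.Vec.Properties as Vec
open import Data.Vec.Membership.Propositional using (_∈_)
open import Data.Vec.Relation.Unary.Any using (here; there)
open import Data.List.Relation.Unary.Any using (here; there)
open import Defs
open import Function using (_∘_; id; _↔_; Equivalence; Injective; Inverse; mk↔ₛ′)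
open import Function.Construct.Composition using (_↔-∘_)
open import Function.Construct.Identity using (↔-id)
open import Function.Construct.Symmetry using (↔-sym)
open import Relation.Binary.Definitions using (DecidableEquality)
open import Relation.Binary.PropositionalEquality
open import Relation.Nullary using (¬_; Dec; yes; no; contradiction; ¬¬-excluded-middle; DoubleNegation)
open import Relation.Nullary.Decidable using (map′; _×-dec_; _⊎-dec_; _→-dec_; ¬?; ⌊_⌋; toWitness; fromWitness; decidable-stable)
open import Relation.Unary using (Decidable)

-- Counters in base `Q + 1`, least significant digit first.

module Counter (Q : ℕ) where

  value : ∀ {d} → (Fin d → ℕ) → ℕ
  value {zero}  g = 0
  value {suc d} g = g zero + suc Q * value (g ∘ suc)

  maximum : ℕ → ℕ
  maximum d = value {d} (λ _ → Q)

  value-mono : ∀ {d} {f g : Fin d → ℕ} → (∀ i → f i ≤ g i) → value f ≤ value g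
  value-mono {zero}  f≤g = z≤n
  value-mono {suc d} f≤g = ℕ.+-mono-≤ (f≤g zero) (ℕ.*-monoʳ-≤ (suc Q) (value-mono (f≤g ∘ suc)))

  private
    carry : ∀ m → suc Q * suc m ≡ suc (Q + suc Q * m)
    carry m = ℕ.*-suc (suc Q) m

  -- Adding one to `g` turns its digits `Q` below `j` into zeros and carries into digit `j`; the
  -- result dominates `f` digit by digit. This limits what Spoiler gains from one permit.
  value-step≤ : ∀ {d} {f g : Fin d → ℕ} j →
    (∀ i → i Fin.< j → f i ≡ 0 × g i ≡ Q) → f j ≤ suc (g j) →
    (∀ i → j Fin.< i → f i ≤ g i) → value f ≤ suc (value g)
  value-step≤ {f = f} {g} zero lower fj upper =
    ℕ.+-mono-≤ fj (ℕ.*-monoʳ-≤ (suc Q) (value-mono λ i → upper (suc i) (s≤s z≤n)))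
  value-step≤ {f = f} {g} (suc j) lower fj upper
    rewrite proj₁ (lower zero (s≤s z≤n)) | proj₂ (lower zero (s≤s z≤n)) = ℕ.≤-trans
      (ℕ.*-monoʳ-≤ (suc Q) (value-step≤ j (λ i i<j → lower (suc i) (s≤s i<j)) fj
        (λ i j<i → upper (suc i) (s≤s j<i))))
      (ℕ.≤-reflexive (carry (value (g ∘ suc))))

  -- A unit of digit `j` outweighs everything stored below it, as those digits are at most `Q`.
  -- Hence resetting the lower digits costs Spoiler less than raising digit `j` gains.
  value-step≥ : ∀ {d} {f g : Fin d → ℕ} j →
    (∀ i → i Fin.< j → g i ≤ Q) → suc (g j) ≤ f j →
    (∀ i → j Fin.< i → g i ≤ f i) → suc (value g) ≤ value f
  value-step≥ {f = f} {g} zero lower fj upper =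
    ℕ.+-mono-≤ fj (ℕ.*-monoʳ-≤ (suc Q) (value-mono λ i → upper (suc i) (s≤s z≤n)))
  value-step≥ {f = f} {g} (suc j) lower fj upper = begin
    suc (g zero + suc Q * value (g ∘ suc)) ≤⟨ s≤s (ℕ.+-monoˡ-≤ _ (lower zero (s≤s z≤n))) ⟩
    suc (Q + suc Q * value (g ∘ suc))      ≡⟨ carry _ ⟨
    suc Q * suc (value (g ∘ suc))          ≤⟨ ℕ.*-monoʳ-≤ (suc Q)
                                               (value-step≥ j (λ i i<j → lower (suc i) (s≤s i<j)) fj
                                                 (λ i j<i → upper (suc i) (s≤s j<i))) ⟩
    suc Q * value (f ∘ suc)                ≤⟨ ℕ.m≤n+m _ (f zero) ⟩
    f zero + suc Q * value (f ∘ suc)       ∎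
    where open ℕ.≤-Reasoning

  maximum≥ : ∀ {d} → 1 ≤ d → Q ^ d ≤ maximum d
  maximum≥ {suc zero}    _ = ℕ.≤-trans (ℕ.≤-reflexive (ℕ.*-identityʳ Q)) (ℕ.m≤m+n Q _)
  maximum≥ {suc (suc d)} _ = begin
    Q * Q ^ suc d               ≤⟨ ℕ.*-mono-≤ (ℕ.n≤1+n Q) (maximum≥ {suc d} (s≤s z≤n)) ⟩
    suc Q * maximum (suc d)     ≤⟨ ℕ.m≤n+m _ Q ⟩
    Q + suc Q * maximum (suc d) ∎
    where open ℕ.≤-Reasoning

-- Nonzero digits as pairs of an element and an answer.

module Code (N : ℕ) where

  -- `suc` reserves 0 for a cleared variable.
  code : Fin N → Fin N → ℕ
  code α β = suc (toℕ (combine β α))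

  code≤ : ∀ α β → code α β ≤ N * N
  code≤ α β = toℕ<n (combine β α)

  code-injectiveʳ : ∀ {α β β′} → code α β ≡ code α β′ → β ≡ β′
  code-injectiveʳ {α} {β} {β′} eq =
    proj₁ (combine-injective β α β′ α (toℕ-injective (ℕ.suc-injective eq)))

  code-surjective : ∀ {m} → m < N * N → ∃₂ λ α β → code α β ≡ suc m
  code-surjective m<Q with remQuot {N} N (fromℕ< m<Q) in eq
  ... | β , α = α , β , cong suc (begin
    toℕ (combine β α)   ≡⟨ cong (λ (β , α) → toℕ (combine β α)) eq ⟨
    toℕ (uncurry combine (remQuot {N} N (fromℕ< m<Q))) ≡⟨ cong toℕ (combine-remQuot {N} N _) ⟩
    toℕ (fromℕ< m<Q)    ≡⟨ toℕ-fromℕ< m<Q ⟩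
    _                   ∎)
    where open ≡-Reasoning

  -- Consecutive codes differ in their first component, which cycles modulo N.
  code-consecutive : 2 ≤ N → ∀ α β β′ → code α β ≢ suc (code α β′)
  code-consecutive 2≤N α β β′ eq = contradiction multiples (impossible (toℕ β) (toℕ β′))
    where
    multiples : N * toℕ β ≡ suc (N * toℕ β′)
    multiples = ℕ.+-cancelʳ-≡ (toℕ α) _ _ (begin
      N * toℕ β + toℕ α          ≡⟨ toℕ-combine β α ⟨
      toℕ (combine β α)          ≡⟨ ℕ.suc-injective eq ⟩
      suc (toℕ (combine β′ α))   ≡⟨ cong suc (toℕ-combine β′ α) ⟩
      suc (N * toℕ β′ + toℕ α)   ∎)
      where open ≡-Reasoning
    impossible : ∀ x y → N * x ≢ suc (N * y)
    impossible x y eq with x ℕ.≤? y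
    ... | yes x≤y = ℕ.<-irrefl eq (s≤s (ℕ.*-monoʳ-≤ N x≤y))
    ... | no  x≰y = ℕ.<-irrefl (sym eq) (begin-strict
      suc (N * y)  <⟨ ℕ.≤-refl ⟩
      2 + N * y    ≤⟨ ℕ.+-monoˡ-≤ _ 2≤N ⟩
      N + N * y    ≡⟨ ℕ.*-suc N y ⟨
      N * suc y    ≤⟨ ℕ.*-monoʳ-≤ N (ℕ.≰⇒> x≰y) ⟩
      N * x        ∎)
      where open ℕ.≤-Reasoning

-- The elements, the rules of the game, and their finite encoding.

module Elements (d M : ℕ) where

  -- More values of z than variables, so that Duplicator can always answer
  -- select X with a z for which clear X z is not present.
  N : ℕ
  N = 3 + d + M

  k Q : ℕ
  k = 2 + d
  Q = N * N

  open Code N public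
  open Counter Q public

  Color : Set
  Color = Fin k

  pattern D   = zero
  pattern P   = suc zero
  pattern G i = suc (suc i)

  Value : Set
  Value = Maybe (Fin N)

  -- A variable holding digit i α in A and just β in B stores the digit
  -- code α β, and clear (suc i) z stores 0.  The answer nothing is void.
  data Elem : Set where
    token      : Value → Elem
    select     : Fin (suc d) → Elem
    ask commit : Elem
    clear      : Fin (suc d) → Fin N → Elem
    permit     : Fin 2 → Fin d → Fin N → Elem
    digit      : Fin d → Fin N → Elem

  -- Tokens have no colour, so none occurs in a colored tuple and `FullRules` never constrains one.
  color : Elem → Maybe Color
  color (token v)      = nothing
  color (select X)     = just D
  color ask            = just D
  color commit         = just D
  color (clear X z)    = just (suc X)
  color (permit b j α) = just P
  color (digit i α)    = just (G i)

  weight : Elem → Value → ℕ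
  weight (digit i α) (just β) = code α β
  weight _           _        = 0

  valueOf : Elem → Value
  valueOf (token v) = v
  valueOf _         = nothing

  bit : Fin N → Fin 2
  bit zero    = zero
  bit (suc _) = suc zero

  unbit : Fin 2 → Fin N
  unbit zero       = zero
  unbit (suc zero) = suc zero

  bit-unbit : ∀ b → bit (unbit b) ≡ b
  bit-unbit zero       = refl
  bit-unbit (suc zero) = refl

  Colored : (Color → Elem) → Set
  Colored c = ∀ X → color (c X) ≡ just X

  module Rules (c : Color → Elem) (w : Color → Value) where

    g : Fin d → ℕ
    g i = weight (c (G i)) (w (G i))

    Live : Color → Set
    Live X = w X ≢ nothing

    SelectRule ClearRule AskRule PermitRule CommitRule DigitRule : Set
    -- Duplicator may answer clear X z with nothing unless select X is present
    -- and was answered z; as he can choose an unused z, Spoiler can only reset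
    -- a variable while D is occupied by select X.
    SelectRule = ∀ X → c D ≡ select X → Live D
    ClearRule  = ∀ X z → c D ≡ select X → w D ≡ just z → c (suc X) ≡ clear X z → Live (suc X)
    AskRule    = ∀ z → c D ≡ ask → c P ≡ clear zero z → Live P → (∀ i → Live (G i)) →
                 Live D × ¬ (∀ i → g i ≡ Q)
    PermitRule = ∀ z j α β → c D ≡ ask → w D ≡ just z → c P ≡ permit (bit z) j α →
                 (∀ i → Live (G i)) → (∀ i → i Fin.< j → g i ≡ Q) →
                 code α β ≡ suc (g j) → w P ≡ just β
    -- The inequality forces Spoiler to place `commit` before `digit j α`. Without it, a `digit j α`
    -- answered earlier with another value could leave `commit` without any legal answer.
    CommitRule = ∀ b j α → c D ≡ commit → c P ≡ permit b j α → Live P →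
                 (∀ i → Live (G i)) → (∀ i → i Fin.< j → g i ≡ 0) →
                 c (G j) ≢ digit j α → Live D
    -- Digit `j` is exempt from the liveness condition because its answer is what the rule forces.
    DigitRule  = ∀ b j α → c D ≡ commit → Live D → c P ≡ permit b j α → Live P →
                 (∀ i → i ≢ j → Live (G i)) → (∀ i → i Fin.< j → g i ≡ 0) →
                 c (G j) ≡ digit j α → w (G j) ≡ w P

    FullRules Legal : Set
    FullRules = AskRule × PermitRule × CommitRule × DigitRule
    Legal     = SelectRule × ClearRule × (Colored c → FullRules)

  open Rules using (FullRules; Legal) public

  size : ℕ
  size = suc N + (suc d + (1 + (1 + (suc d * N + (2 * (d * N) + d * N)))))

  Elem↔Fin : Elem ↔ Fin size
  Elem↔Fin = ↔-sym (maybe ⊎F ↔-id _ ⊎F 1↔⊤ ⊎F 1↔⊤ ⊎F *↔× ⊎F ((↔-id _ ×-↔ *↔×) ↔-∘ *↔×) ⊎F *↔×) ↔-∘ sum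
    where
    infixr 5 _⊎F_
    _⊎F_ : ∀ {m n} {A B : Set} → Fin m ↔ A → Fin n ↔ B → Fin (m + n) ↔ (A ⊎ B)
    f ⊎F g = (f ⊎-↔ g) ↔-∘ +↔⊎
    maybe : Fin (suc N) ↔ Value
    maybe = mk↔ₛ′ (λ { zero → nothing ; (suc i) → just i }) (λ { nothing → zero ; (just i) → suc i })
      (λ { nothing → refl ; (just i) → refl }) (λ { zero → refl ; (suc i) → refl })
    sum : Elem ↔ (Value ⊎ Fin (suc d) ⊎ ⊤ ⊎ ⊤ ⊎ (Fin (suc d) × Fin N) ⊎
                  (Fin 2 × Fin d × Fin N) ⊎ (Fin d × Fin N))
    sum = mk↔ₛ′
      (λ { (token v)      → inj₁ v
         ; (select X)     → inj₂ (inj₁ X)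
         ; ask            → inj₂ (inj₂ (inj₁ tt))
         ; commit         → inj₂ (inj₂ (inj₂ (inj₁ tt)))
         ; (clear X z)    → inj₂ (inj₂ (inj₂ (inj₂ (inj₁ (X , z)))))
         ; (permit b j α) → inj₂ (inj₂ (inj₂ (inj₂ (inj₂ (inj₁ (b , j , α))))))
         ; (digit i α)    → inj₂ (inj₂ (inj₂ (inj₂ (inj₂ (inj₂ (i , α)))))) })
      (λ { (inj₁ v)                                           → token v
         ; (inj₂ (inj₁ X))                                    → select X
         ; (inj₂ (inj₂ (inj₁ tt)))                            → ask
         ; (inj₂ (inj₂ (inj₂ (inj₁ tt))))                     → commit
         ; (inj₂ (inj₂ (inj₂ (inj₂ (inj₁ (X , z))))))         → clear X z
         ; (inj₂ (inj₂ (inj₂ (inj₂ (inj₂ (inj₁ (b , j , α))))))) → permit b j α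
         ; (inj₂ (inj₂ (inj₂ (inj₂ (inj₂ (inj₂ (i , α)))))))  → digit i α })
      (λ { (inj₁ v) → refl
         ; (inj₂ (inj₁ X)) → refl
         ; (inj₂ (inj₂ (inj₁ tt))) → refl
         ; (inj₂ (inj₂ (inj₂ (inj₁ tt)))) → refl
         ; (inj₂ (inj₂ (inj₂ (inj₂ (inj₁ (X , z)))))) → refl
         ; (inj₂ (inj₂ (inj₂ (inj₂ (inj₂ (inj₁ (b , j , α))))))) → refl
         ; (inj₂ (inj₂ (inj₂ (inj₂ (inj₂ (inj₂ (i , α))))))) → refl })
      (λ { (token v) → refl ; (select X) → refl ; ask → refl ; commit → refl
         ; (clear X z) → refl ; (permit b j α) → refl ; (digit i α) → refl })

  infix 4 _≟ᵉ_ _≟ᵛ_ _≟ᶜ_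

  abstract
    _≟ᵉ_ : DecidableEquality Elem
    a ≟ᵉ a′ = map′ injective (cong to) (to a ≟ to a′)
      where
      open Inverse Elem↔Fin
      injective : ∀ {a a′} → to a ≡ to a′ → a ≡ a′
      injective eq = trans (sym (strictlyInverseʳ _)) (trans (cong from eq) (strictlyInverseʳ _))

  _≟ᵛ_ : DecidableEquality Value
  _≟ᵛ_ = Maybe.≡-dec _≟_

  _≟ᶜ_ : DecidableEquality (Maybe Color)
  _≟ᶜ_ = Maybe.≡-dec _≟_

  module _ (c : Color → Elem) (w : Color → Value) where
    open Rules c w hiding (Legal; FullRules)

    private
      live? : ∀ X → Dec (Live X)
      live? X = ¬? (w X ≟ᵛ nothing)

      below? : ∀ (j : Fin d) m → Dec (∀ i → i Fin.< j → g i ≡ m)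
      below? j m = all? λ i → (i <? j) →-dec (g i ℕ.≟ m)

    abstract
      legal? : Dec (Legal c w)
      legal? =
        (all? λ X → c D ≟ᵉ select X →-dec live? D) ×-dec
        (all? λ X → all? λ z → c D ≟ᵉ select X →-dec w D ≟ᵛ just z →-dec
           c (suc X) ≟ᵉ clear X z →-dec live? (suc X)) ×-dec
        ((all? λ X → color (c X) ≟ᶜ just X) →-dec
          ((all? λ z → c D ≟ᵉ ask →-dec c P ≟ᵉ clear zero z →-dec live? P →-dec
             (all? λ i → live? (G i)) →-dec
             live? D ×-dec ¬? (all? λ i → g i ℕ.≟ Q)) ×-dec
           (all? λ z → all? λ j → all? λ α → all? λ β →
             c D ≟ᵉ ask →-dec w D ≟ᵛ just z →-dec c P ≟ᵉ permit (bit z) j α →-dec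
             (all? λ i → live? (G i)) →-dec below? j Q →-dec
             code α β ℕ.≟ suc (g j) →-dec w P ≟ᵛ just β) ×-dec
           (all? λ b → all? λ j → all? λ α →
             c D ≟ᵉ commit →-dec c P ≟ᵉ permit b j α →-dec live? P →-dec
             (all? λ i → live? (G i)) →-dec below? j 0 →-dec
             ¬? (c (G j) ≟ᵉ digit j α) →-dec live? D) ×-dec
           (all? λ b → all? λ j → all? λ α →
             c D ≟ᵉ commit →-dec live? D →-dec c P ≟ᵉ permit b j α →-dec live? P →-dec
             (all? λ i → ¬? (i ≟ j) →-dec live? (G i)) →-dec below? j 0 →-dec
             c (G j) ≟ᵉ digit j α →-dec w (G j) ≟ᵛ w P)))

  module Coding (n : ℕ) (size≤n : size ≤ n) where
    private
      module E = Inverse Elem↔Fin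

    -- The surplus of the domain consists of further copies of `token nothing`, so that every
    -- cardinality from `size` on is reached.
    decode : Fin n → Elem
    decode x with toℕ x ℕ.<? size
    ... | yes x<size = E.from (fromℕ< x<size)
    ... | no  _      = token nothing

    encode : Elem → Fin n
    encode a = inject≤ (E.to a) size≤n

    decode-encode : ∀ a → decode (encode a) ≡ a
    decode-encode a with toℕ (encode a) ℕ.<? size
    ... | yes lt  = trans (cong E.from
          (trans (fromℕ<-cong _ _ (toℕ-inject≤ (E.to a) size≤n) lt (toℕ<n _))
                 (fromℕ<-toℕ (E.to a) (toℕ<n _)))) (E.strictlyInverseʳ a)
    ... | no  nlt = contradiction
          (subst (ℕ._< size) (sym (toℕ-inject≤ (E.to a) size≤n)) (toℕ<n (E.to a))) nlt

-- The two structures.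

module Structures (d M n : ℕ) (decode : Fin n → Elements.Elem d M)
  (encode : Elements.Elem d M → Fin n) (decode-encode : ∀ a → decode (encode a) ≡ a) where

  open Elements d M

  -- In `ℬ` only tokens carry a value; all other elements are copies of the void answer.
  read : Fin n → Value
  read = valueOf ∘ decode

  σ : Signature
  σ = record { #relations = n ^ k ; arity = λ _ → k }

  pattern-of : Relation σ → Vec Elem k
  pattern-of R = tabulate (decode ∘ finToFun R)

  relation-of : Vec Elem k → Relation σ
  relation-of c = funToFin (encode ∘ lookup c)

  pattern-relation : ∀ c → pattern-of (relation-of c) ≡ c
  pattern-relation c = trans
    (Vec.tabulate-cong λ X → trans (cong decode (finToFun-funToFin (encode ∘ lookup c) X))
                                   (decode-encode (lookup c X)))
    (Vec.tabulate∘lookup c)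

  LegalVec : Vec Elem k → Vec Value k → Set
  LegalVec c w = Legal (lookup c) (lookup w)

  legalVec? : ∀ c w → Dec (LegalVec c w)
  legalVec? c w = legal? (lookup c) (lookup w)

  -- The tokens of A form a copy of B; hence B maps homomorphically into A.
  InA : Vec Elem k → Vec Elem k → Set
  InA c t = t ≡ c ⊎ t ≡ map token (map valueOf t) × LegalVec c (map valueOf t)

  inA? : ∀ c t → Dec (InA c t)
  inA? c t = Vec.≡-dec _≟ᵉ_ t c ⊎-dec
    (Vec.≡-dec _≟ᵉ_ t (map token (map valueOf t)) ×-dec legalVec? c (map valueOf t))

  𝒜 ℬ : Structure σ n
  𝒜 = record { interp = λ R t → ⌊ inA? (pattern-of R) (map decode t) ⌋ }
  ℬ = record { interp = λ R y → ⌊ legalVec? (pattern-of R) (map read y) ⌋ }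

-- Duplicator's invariants and strategy.

module Duplicator (d M : ℕ) where
  open Elements d M

  L : ℕ
  L = maximum d

  -- Answers depend on the element alone and not on the variable holding it, so equalities are
  -- preserved.
  Response : Set
  Response = Elem → Value

  -- Presence comes without a decision procedure; case distinctions on it are made under double
  -- negation.
  Present : Set₁
  Present = Elem → Set

  -- Zero always counts as attained, because Spoiler may reset any digit; the bounds then cover
  -- every counter that resets can produce.
  data Attained (S : Present) (h : Response) (i : Fin d) : ℕ → Set where
    none : Attained S h i 0
    some : ∀ {α β} → S (digit i α) → h (digit i α) ≡ just β → Attained S h i (code α β)

  record Legality (S : Present) (h : Response) : Set where
    field
      tokens   : ∀ v → h (token v) ≡ v
      selected : ∀ {X} → S (select X) → h (select X) ≢ nothing
      cleared  : ∀ {X z} → S (select X) → h (select X) ≡ just z → S (clear X z) → h (clear X z) ≢ nothing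
      full     : ∀ {c w} → Colored c → (∀ X → S (c X)) → (∀ X → w X ≡ h (c X)) → FullRules c w

  -- Lower bounds for the distance of the counter from its maximum: `p` as it stands, `q` after a
  -- live permit has been used, `r` after the advance that a live `ask` allows.
  record Bounds (p q r : ℕ) (S : Present) (h : Response) : Set where
    field
      total     : ∀ {f} → (∀ i → Attained S h i (f i)) → p + value f ≤ L
      permitted : ∀ {b j α β f} → S (permit b j α) → h (permit b j α) ≡ just β →
                  (∀ i → j Fin.< i → Attained S h i (f i)) → f j ≤ code α β →
                  (∀ i → i Fin.< j → f i ≡ 0) → q + value f ≤ L
      asked     : ∀ {f} → S ask → h ask ≢ nothing → (∀ i → Attained S h i (f i)) →
                  suc r + value f ≤ L

  open Legality
  open Bounds

  -- A colored tuple occupies all k variables.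
  Small : Present → Set
  Small S = ∀ {c} → Colored c → (∀ X → S (c X)) → ∀ {a} → S a → ∃[ X ] a ≡ c X

  infix 4 _⊑_
  -- Tokens are disregarded: their answers are fixed, and they occur in no bound.
  _⊑_ : Present → Present → Set
  S ⊑ S′ = ∀ {a X} → color a ≡ just X → S a → S′ a

  module _ {S S′ : Present} (S⊑ : S ⊑ S′) {h : Response} where

    restrict-attained : ∀ {i m} → Attained S h i m → Attained S′ h i m
    restrict-attained none       = none
    restrict-attained (some s e) = some (S⊑ refl s) e

    restrict-legality : Legality S′ h → Legality S h
    restrict-legality leg = record
      { tokens   = tokens leg
      ; selected = λ s → selected leg (S⊑ refl s)
      ; cleared  = λ s e s′ → cleared leg (S⊑ refl s) e (S⊑ refl s′)
      ; full     = λ col s → full leg col (λ X → S⊑ (col X) (s X)) }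

    restrict-bounds : ∀ {p q r} → Bounds p q r S′ h → Bounds p q r S h
    restrict-bounds bd = record
      { total     = λ at → total bd (restrict-attained ∘ at)
      ; permitted = λ s e at → permitted bd (S⊑ refl s) e (λ i → restrict-attained ∘ at i)
      ; asked     = λ s e at → asked bd (S⊑ refl s) e (restrict-attained ∘ at) }

  -- Without `ask` on the board the condition `asked` is vacuous, which lets `r` be raised again.
  forget-ask : ∀ {p q r r′ S h} → ¬ S ask → Bounds p q r S h → Bounds p q r′ S h
  forget-ask ¬ask bd = record
    { total = total bd ; permitted = permitted bd ; asked = λ s → contradiction s ¬ask }

  weaken : ∀ {p q r p′ q′ r′ S h} → p′ ≤ p → q′ ≤ q → r′ ≤ r → Bounds p q r S h → Bounds p′ q′ r′ S h
  weaken p≤ q≤ r≤ bd = record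
    { total     = λ at → ℕ.≤-trans (ℕ.+-monoˡ-≤ _ p≤) (total bd at)
    ; permitted = λ s e at fj l → ℕ.≤-trans (ℕ.+-monoˡ-≤ _ q≤) (permitted bd s e at fj l)
    ; asked     = λ s e at → ℕ.≤-trans (s≤s (ℕ.+-monoˡ-≤ _ r≤)) (asked bd s e at) }

  attained : ∀ {S h i} a → color a ≡ just (G i) → S a → Attained S h i (weight a (h a))
  attained (clear (suc i) z) refl s = none
  attained {h = h} (digit i α) refl s with h (digit i α) in eq
  ... | nothing = none
  ... | just β  = some s eq

  infixl 6 _▷_ _[_↦_]

  _▷_ : Present → Elem → Present
  (S ▷ a) a′ = a′ ≡ a ⊎ S a′

  _[_↦_] : Response → Elem → Value → Response
  (h [ a ↦ v ]) a′ with a′ ≟ᵉ a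
  ... | yes _ = v
  ... | no  _ = h a′

  updated : ∀ h a v → (h [ a ↦ v ]) a ≡ v
  updated h a v with a ≟ᵉ a
  ... | yes _  = refl
  ... | no a≢a = contradiction refl a≢a

  unchanged : ∀ {h a v a′} → a′ ≢ a → (h [ a ↦ v ]) a′ ≡ h a′
  unchanged {a = a} {a′ = a′} a′≢a with a′ ≟ᵉ a
  ... | yes eq = contradiction eq a′≢a
  ... | no  _  = refl

  -- Answers that create no live `ask`, no live permit and no stored digit, and so leave all bounds
  -- intact.
  Tame : Elem → Value → Set
  Tame ask            v = v ≡ nothing
  Tame (permit _ _ _) v = v ≡ nothing
  Tame (digit _ _)    v = v ≡ nothing
  Tame _              v = ⊤

  module _ {S : Present} {h : Response} {a : Elem} (fresh : ¬ S a) where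

    unchangedˢ : ∀ {v a′} → S a′ → (h [ a ↦ v ]) a′ ≡ h a′
    unchangedˢ s = unchanged λ { refl → fresh s }

    drop-attained : ∀ {v i m} → (∀ {α} → a ≡ digit i α → v ≡ nothing) →
                    Attained (S ▷ a) (h [ a ↦ v ]) i m → Attained S h i m
    drop-attained tame none = none
    drop-attained tame (some (inj₂ s) e) = some s (trans (sym (unchangedˢ s)) e)
    drop-attained {v} tame (some (inj₁ refl) e) with refl ← tame refl | () ← trans (sym (updated h a v)) e

    tame-bounds : ∀ {v p q r} → Tame a v → Bounds p q r S h → Bounds p q r (S ▷ a) (h [ a ↦ v ])
    tame-bounds {v} tame bd = record
      { total     = λ at → total bd (λ i → drop (at i))
      ; permitted = λ
          { (inj₁ refl) e → contradiction (trans (sym e) (trans (updated h a v) tame)) λ ()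
          ; (inj₂ s)    e at → permitted bd s (trans (sym (unchangedˢ s)) e) (λ i j<i → drop (at i j<i)) }
      ; asked     = λ
          { (inj₁ refl) e    → contradiction (trans (updated h a v) tame) e
          ; (inj₂ s)    e at → asked bd s (λ e′ → e (trans (unchangedˢ s) e′)) (λ i → drop (at i)) } }
      where
      drop : ∀ {i m} → Attained (S ▷ a) (h [ a ↦ v ]) i m → Attained S h i m
      drop = drop-attained λ { refl → tame }

  record NewTuple (S : Present) (a : Elem) (Y : Color) (c : Color → Elem) : Set where
    field
      colored : Colored c
      new     : c Y ≡ a
      old     : ∀ {X} → X ≢ Y → S (c X)

    present : ∀ X → (S ▷ a) (c X)
    present X with X ≟ Y
    ... | yes refl = inj₁ new
    ... | no X≢Y   = inj₂ (old X≢Y)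

  module NewTuples {S : Present} {h : Response} {a : Elem} {Y : Color}
    (color-a : color a ≡ just Y) (fresh : ¬ S a) (small : Small (S ▷ a)) where

    open NewTuple

    private
      off : ∀ {v a′} → S a′ → (h [ a ↦ v ]) a′ ≡ h a′
      off {a′ = a′} = unchangedˢ {S} {h} {a} fresh {a′ = a′}

    -- The tuple already exhausts the board by `Small`, so each colour is represented by its entry
    -- alone.
    locate : ∀ {c a′ X} → NewTuple S a Y c → color a′ ≡ just X → (S ▷ a) a′ → a′ ≡ c X
    locate n ca s with small (colored n) (present n) s
    ... | X′ , refl with refl ← trans (sym ca) (colored n X′) = refl

    unique : ∀ {c c′} → NewTuple S a Y c → NewTuple S a Y c′ → ∀ X → c′ X ≡ c X
    unique n n′ X = locate n (colored n′ X) (present n′ X)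

    NewRules : Value → Set
    NewRules v = ∀ {c w} → NewTuple S a Y c → (∀ {X} → X ≢ Y → w X ≡ h (c X)) → w Y ≡ v → FullRules c w

    -- Colored tuples without `a` keep their old answers, so the full rules have to be checked only
    -- for tuples with `a` at `Y`.
    extend : ∀ {v} → Legality S h →
      (∀ {X} → a ≡ select X → v ≢ nothing) →
      (∀ {X z} → a ≡ select X → v ≡ just z → ¬ S (clear X z)) →
      (∀ {X z} → a ≡ clear X z → S (select X) → h (select X) ≡ just z → v ≢ nothing) →
      NewRules v → Legality (S ▷ a) (h [ a ↦ v ])
    extend {v} leg sel sel-clear clear-sel rules = record
      { tokens   = λ u → trans (unchanged λ { refl → contradiction color-a λ () }) (tokens leg u)
      ; selected = λ
          { (inj₁ refl) e → sel refl (trans (sym (updated h a v)) e)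
          ; (inj₂ s)    e → selected leg s (trans (sym (off s)) e) }
      ; cleared  = λ
          { (inj₁ refl) e (inj₂ s)      → contradiction s (sel-clear refl (trans (sym (updated h a v)) e))
          ; (inj₂ s)    e (inj₁ refl) u → clear-sel refl s (trans (sym (off s)) e)
                                            (trans (sym (updated h a v)) u)
          ; (inj₂ s)    e (inj₂ s′)   u → cleared leg s (trans (sym (off s)) e) s′
                                            (trans (sym (off s′)) u) }
      ; full     = full′ }
      where
      full′ : ∀ {c w} → Colored c → (∀ X → (S ▷ a) (c X)) → (∀ X → w X ≡ (h [ a ↦ v ]) (c X)) → FullRules c w
      full′ {c} {w} col s e with c Y ≟ᵉ a
      ... | yes cY≡a = rules record { colored = col ; new = cY≡a ; old = old′ }
              (λ X≢Y → trans (e _) (off (old′ X≢Y)))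
              (trans (e Y) (trans (cong (h [ a ↦ v ]) cY≡a) (updated h a v)))
        where
        old′ : ∀ {X} → X ≢ Y → S (c X)
        old′ {X} X≢Y with s X
        ... | inj₂ sX = sX
        ... | inj₁ eq = contradiction
                (just-injective (trans (sym (col X)) (trans (cong color eq) color-a))) X≢Y
      ... | no cY≢a = full leg col old′ (λ X → trans (e X) (off (old′ X)))
        where
        old′ : ∀ X → S (c X)
        old′ X with s X
        ... | inj₂ sX = sX
        ... | inj₁ eq with refl ← trans (sym (col X)) (trans (cong color eq) color-a) = contradiction eq cY≢a

  open NewTuple

  module Moves {S : Present} {h : Response} (leg : Legality S h) where

    private
      idle : ∀ c w → c D ≢ ask → c D ≢ commit → FullRules c w
      idle c w ¬ask ¬commit =
        (λ _ e → contradiction e ¬ask) , (λ _ _ _ _ e → contradiction e ¬ask) ,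
        (λ _ _ _ e → contradiction e ¬commit) , (λ _ _ _ e → contradiction e ¬commit)

      is : ∀ {A : Set} {x y z : A} → x ≡ y → x ≡ z → y ≡ z
      is e e′ = trans (sym e) e′

    module _ {X} (fresh : ¬ S (select X)) (small : Small (S ▷ select X)) where
      open NewTuples {S} {h} {select X} {D} refl fresh small

      select-live : ∀ {z} → ¬ S (clear X z) → Legality (S ▷ select X) (h [ select X ↦ just z ])
      select-live ¬s = extend leg (λ _ ()) (λ { refl refl s → ¬s s }) (λ ())
        (λ {c} {w} n _ _ → idle c w (λ e → contradiction (is (new n) e) λ ()) (λ e → contradiction (is (new n) e) λ ()))

    module _ {X z} (fresh : ¬ S (clear X z)) (small : Small (S ▷ clear X z)) where
      open NewTuples {S} {h} {clear X z} {suc X} refl fresh small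

      -- Every new tuple has `select X` at `D`, and the full rules concern only `ask` and `commit`
      -- there.
      clear-live : S (select X) → Legality (S ▷ clear X z) (h [ clear X z ↦ just zero ])
      clear-live s = extend leg (λ ()) (λ ()) (λ _ _ _ ()) λ {c} {w} n _ _ →
        idle c w (λ e → contradiction (trans (locate n refl (inj₂ s)) e) λ ())
             (λ e → contradiction (trans (locate n refl (inj₂ s)) e) λ ())

      -- A void answer disables all full rules: each one requires this variable to be live or to
      -- hold an element other than `clear X z`.
      clear-dead : (S (select X) → h (select X) ≢ just z) → Legality (S ▷ clear X z) (h [ clear X z ↦ nothing ])
      clear-dead ¬sel = extend leg (λ ()) (λ ()) (λ { refl s e → contradiction e (¬sel s) }) (rules X refl)
        where
        rules : ∀ X′ → X′ ≡ X → NewRules nothing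
        rules zero refl n _ wP =
          (λ _ _ _ live → contradiction wP live) ,
          (λ _ _ _ _ _ _ e → contradiction (is (new n) e) λ ()) ,
          (λ _ _ _ _ _ live → contradiction wP live) ,
          (λ _ _ _ _ _ _ live → contradiction wP live)
        rules (suc i) refl n _ wG =
          (λ _ _ _ _ live → contradiction wG (live i)) ,
          (λ _ _ _ _ _ _ _ live → contradiction wG (live i)) ,
          (λ _ _ _ _ _ _ live → contradiction wG (live i)) ,
          digits
          where
          digits : _
          digits b j α _ _ _ _ live _ cG with i ≟ j
          ... | yes refl = contradiction (is (new n) cG) λ ()
          ... | no i≢j   = contradiction wG (live i i≢j)

    module _ (fresh : ¬ S commit) (small : Small (S ▷ commit)) where
      open NewTuples {S} {h} {commit} {D} refl fresh small

      -- Covers every situation in which `CommitRule` demands a live answer. The later records with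
      -- this suffix do the same for their rules.
      record CommitForced : Set where
        field
          {c}       : Color → Elem
          {b j α}   : _
          tuple     : NewTuple S commit D c
          at-permit : c P ≡ permit b j α
          ≢digit    : c (G j) ≢ digit j α

      commit-dead : ¬ CommitForced → Legality (S ▷ commit) (h [ commit ↦ nothing ])
      commit-dead ¬forced = extend leg (λ ()) (λ ()) (λ ()) λ n e wD →
        (λ _ cD → contradiction (is (new n) cD) λ ()) ,
        (λ _ _ _ _ cD → contradiction (is (new n) cD) λ ()) ,
        (λ b j α _ cP live lives zeros ≢dig → contradiction
           (record { tuple = n ; at-permit = cP ; ≢digit = ≢dig }) ¬forced) ,
        (λ _ _ _ _ live → contradiction wD live)

      -- The only new tuple does not hold `digit j α`, so `DigitRule` has nothing to enforce yet.
      commit-live : CommitForced → Legality (S ▷ commit) (h [ commit ↦ just zero ])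
      commit-live forced = extend leg (λ ()) (λ ()) (λ ()) λ {_} {w} n e wD →
        (λ _ cD → contradiction (is (new n) cD) λ ()) ,
        (λ _ _ _ _ cD → contradiction (is (new n) cD) λ ()) ,
        (λ _ _ _ _ _ _ _ _ _ wD′ → contradiction (is wD wD′) λ ()) ,
        (λ b j α _ _ cP _ _ _ cG → clash w n cP cG)
        where
        open CommitForced forced renaming (c to c₀; tuple to n₀; j to j₀)
        clash : ∀ {c b j α} w → NewTuple S commit D c → c P ≡ permit b j α →
                c (G j) ≡ digit j α → w (G j) ≡ w P
        clash w n cP cG with refl ← is at-permit (trans (unique n n₀ P) cP) =
          contradiction (trans (unique n n₀ (G j₀)) cG) ≢digit

    module _ (fresh : ¬ S ask) (small : Small (S ▷ ask)) where
      open NewTuples {S} {h} {ask} {D} refl fresh small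

      record AskForced : Set where
        field
          {c}      : Color → Elem
          {z}      : _
          tuple    : NewTuple S ask D c
          at-clear : c P ≡ clear zero z

      ask-dead : ¬ AskForced → Legality (S ▷ ask) (h [ ask ↦ nothing ])
      ask-dead ¬forced = extend leg (λ ()) (λ ()) (λ ()) λ n e wD →
        (λ z cD cP live lives → contradiction (record { tuple = n ; at-clear = cP }) ¬forced) ,
        (λ _ _ _ _ _ wD′ → contradiction (is wD wD′) λ ()) ,
        (λ _ _ _ cD → contradiction (is (new n) cD) λ ()) ,
        (λ _ _ _ cD → contradiction (is (new n) cD) λ ())

      -- The bound `suc p` keeps the counter off its maximum, as `AskRule` demands. While `P` holds
      -- a `clear`, `PermitRule` does not apply, so `z` can be chosen freely.
      ask-live : ∀ {p q r} → Bounds (suc p) q r S h → AskForced →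
                 ∀ z → Legality (S ▷ ask) (h [ ask ↦ just z ])
      ask-live bd forced z = extend leg (λ ()) (λ ()) (λ ()) λ {_} {w} n e wD →
        (λ _ _ _ _ _ → (λ wD′ → contradiction (is wD wD′) λ ()) , notAllQ w n e) ,
        (λ _ _ _ _ _ _ cP → contradiction (is (trans (unique n n₀ P) cP) at-clear) λ ()) ,
        (λ _ _ _ cD → contradiction (is (new n) cD) λ ()) ,
        (λ _ _ _ cD → contradiction (is (new n) cD) λ ())
        where
        open AskForced forced renaming (tuple to n₀)
        notAllQ : ∀ {c} w → NewTuple S ask D c → (∀ {X} → X ≢ D → w X ≡ h (c X)) →
                  ¬ (∀ i → weight (c (G i)) (w (G i)) ≡ Q)
        notAllQ {c} w n e all = ℕ.<-irrefl refl (ℕ.≤-trans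
          (s≤s (ℕ.≤-trans (value-mono λ i → ℕ.≤-reflexive (sym (trans (cong (weight (c (G i))) (sym (e λ ()))) (all i))))
                          (ℕ.m≤n+m _ _)))
          (total bd λ i → attained {S} {h} (c (G i)) (colored n (G i)) (old n λ ())))

    module _ {b j α} (fresh : ¬ S (permit b j α)) (small : Small (S ▷ permit b j α)) where
      open NewTuples {S} {h} {permit b j α} {P} refl fresh small

      private
        weights : (Color → Elem) → Fin d → ℕ
        weights c i = weight (c (G i)) (h (c (G i)))

      record PermitForced : Set where
        field
          {c}      : Color → Elem
          {z β}    : Fin N
          tuple    : NewTuple S (permit b j α) P c
          at-ask   : c D ≡ ask
          answer   : h ask ≡ just z
          same-bit : bit z ≡ b
          maximal  : ∀ i → i Fin.< j → weights c i ≡ Q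
          next     : code α β ≡ suc (weights c j)

      permit-dead : ¬ PermitForced → Legality (S ▷ permit b j α) (h [ permit b j α ↦ nothing ])
      permit-dead ¬forced = extend leg (λ ()) (λ ()) (λ ()) λ {_} {w} n e wP →
        (λ _ _ _ live → contradiction wP live) ,
        (λ z j α β cD wD cP _ maxs next → contradiction (forced β w n e cD wD (is cP (new n)) maxs next) ¬forced) ,
        (λ _ _ _ _ _ live → contradiction wP live) ,
        (λ _ _ _ _ _ _ live → contradiction wP live)
        where
        forced : ∀ {c z j′ α′} β w → NewTuple S (permit b j α) P c → (∀ {X} → X ≢ P → w X ≡ h (c X)) →
          c D ≡ ask → w D ≡ just z → permit (bit z) j′ α′ ≡ permit b j α →
          (∀ i → i Fin.< j′ → weight (c (G i)) (w (G i)) ≡ Q) →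
          code α′ β ≡ suc (weight (c (G j′)) (w (G j′))) → PermitForced
        forced {c} β w n e cD wD refl maxs next = record
          { β = β ; tuple = n ; at-ask = cD ; same-bit = refl
          ; answer = trans (cong h (sym cD)) (trans (sym (e λ ())) wD)
          ; maximal = λ i i<j → trans (cong (weight (c (G i))) (sym (e λ ()))) (maxs i i<j)
          ; next = trans next (cong (suc ∘ weight (c (G j))) (e λ ())) }

      module _ (forced : PermitForced) where
        open PermitForced forced renaming (c to c₀; tuple to n₀)

        permit-live : Legality (S ▷ permit b j α) (h [ permit b j α ↦ just β ])
        permit-live = extend leg (λ ()) (λ ()) (λ ()) λ {_} {w} n e wP →
          (λ _ _ cP → contradiction (is (new n) cP) λ ()) ,
          (λ z j α β cD wD cP _ _ next → trans wP (same β w n e (is (new n) cP) next)) ,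
          (λ _ _ _ cD → contradiction (is at-ask (trans (unique n n₀ D) cD)) λ ()) ,
          (λ _ _ _ cD → contradiction (is at-ask (trans (unique n n₀ D) cD)) λ ())
          where
          -- All new tuples coincide, hence prescribe the same code, and together with `α` the code
          -- determines the answer.
          same : ∀ {c b′ j′ α′} β′ w → NewTuple S (permit b j α) P c → (∀ {X} → X ≢ P → w X ≡ h (c X)) →
            permit b j α ≡ permit b′ j′ α′ → code α′ β′ ≡ suc (weight (c (G j′)) (w (G j′))) → just β ≡ just β′
          same {c} β′ w n e refl next′ = cong just (code-injectiveʳ {α} {β} {β′} (trans next (sym (trans next′ (cong suc
            (trans (cong (weight (c (G j))) (e λ ())) (cong (λ a → weight a (h a)) (sym (unique n n₀ (G j))))))))))

        -- The permit raises the counter by at most one, and the live `ask` on the board guarantees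
        -- `r` further advances after that.
        permit-bounds : ∀ {p q r} → Bounds p q r S h → Bounds p r r (S ▷ permit b j α) (h [ permit b j α ↦ just β ])
        permit-bounds {r = r} bd = record
          { total = λ at → total bd (λ i → drop (at i))
          ; permitted = λ s e at → only (locate n₀ refl s) e (λ i j<i → drop (at i j<i))
          ; asked = λ { (inj₂ s) e at → asked bd s (λ e′ → e (trans (unchangedˢ {S} {h} {permit b j α} fresh s) e′))
                                                    (λ i → drop (at i)) } }
          where
          drop : ∀ {i m} → Attained (S ▷ permit b j α) (h [ permit b j α ↦ just β ]) i m → Attained S h i m
          drop = drop-attained fresh λ ()
          upper : ∀ {i m} → Attained S h i m → m ≤ weights c₀ i
          upper none = z≤n
          upper (some {α′} {β′} s e) with locate n₀ refl (inj₂ s)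
          ... | eq = ℕ.≤-reflexive (trans (cong (weight (digit _ α′)) (sym e)) (cong (λ a → weight a (h a)) eq))
          only : ∀ {b′ j′ α′ β′ f} → permit b′ j′ α′ ≡ c₀ P →
            (h [ permit b j α ↦ just β ]) (permit b′ j′ α′) ≡ just β′ →
            (∀ i → j′ Fin.< i → Attained S h i (f i)) → f j′ ≤ code α′ β′ → (∀ i → i Fin.< j′ → f i ≡ 0) →
            r + value f ≤ L
          only {f = f} eq e at fj lower with refl ← trans eq (new n₀)
            with refl ← is (updated h (permit b j α) (just β)) e = begin
            r + value f                  ≤⟨ ℕ.+-monoʳ-≤ r (value-step≤ j (λ i i<j → lower i i<j , maximal i i<j)
                                              (subst (f j ≤_) next fj) (λ i j<i → upper (at i j<i))) ⟩
            r + suc (value (weights c₀)) ≡⟨ ℕ.+-suc r _ ⟩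
            suc r + value (weights c₀)   ≤⟨ asked bd (subst S at-ask (old n₀ λ ()))
                                              (λ e′ → contradiction (is answer e′) λ ())
                                              (λ i → attained {S} {h} (c₀ (G i)) (colored n₀ (G i)) (old n₀ λ ())) ⟩
            L                            ∎
            where open ℕ.≤-Reasoning

    module _ {j α} (fresh : ¬ S (digit j α)) (small : Small (S ▷ digit j α)) where
      open NewTuples {S} {h} {digit j α} {G j} refl fresh small

      private
        a : Elem
        a = digit j α

      record DigitForced : Set where
        field
          {c}       : Color → Elem
          {b}       : Fin 2
          {β}       : Fin N
          tuple     : NewTuple S (digit j α) (G j) c
          at-commit : c D ≡ commit
          at-permit : c P ≡ permit b j α
          answer    : h (permit b j α) ≡ just β
          zeros     : ∀ i → i Fin.< j → weight (c (G i)) (h (c (G i))) ≡ 0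

      digit-dead : ¬ DigitForced → Legality (S ▷ a) (h [ a ↦ nothing ])
      digit-dead ¬forced = extend leg (λ ()) (λ ()) (λ ()) λ {_} {w} n e wG →
        (λ _ _ _ _ live → contradiction wG (live j)) ,
        (λ _ _ _ _ _ _ _ live → contradiction wG (live j)) ,
        (λ _ _ _ _ _ _ live → contradiction wG (live j)) ,
        (λ b j′ α′ → digits w n e wG b j′ α′)
        where
        digits : ∀ {c} w → NewTuple S a (G j) c → (∀ {X} → X ≢ G j → w X ≡ h (c X)) → w (G j) ≡ nothing →
                 Rules.DigitRule c w
        digits {c} w n e wG b j′ α′ cD wD cP wP live zeros cG with j ≟ j′
        ... | no j≢j′  = contradiction wG (live j j≢j′)
        ... | yes refl with refl ← is (new n) cG | w P in eq
        ...   | nothing = contradiction refl wP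
        ...   | just β  = contradiction (record
          { tuple = n ; at-commit = cD ; at-permit = cP
          ; answer = trans (cong h (sym cP)) (trans (sym (e λ ())) eq)
          ; zeros = λ i i<j → trans (cong (weight (c (G i))) (sym (e λ { refl → ℕ.<-irrefl refl i<j }))) (zeros i i<j) })
          ¬forced

      module _ (forced : DigitForced) where
        open DigitForced forced renaming (c to c₀; tuple to n₀; b to b₀)

        private
          only-permit : ∀ {b j′ α′} → S (permit b j′ α′) → permit b j′ α′ ≡ permit b₀ j α
          only-permit s = trans (locate n₀ refl (inj₂ s)) at-permit

        digit-live : Legality (S ▷ a) (h [ a ↦ just β ])
        digit-live = extend leg (λ ()) (λ ()) (λ ()) λ {_} {w} n e wG →
          (λ _ cD → contradiction (is at-commit (trans (unique n n₀ D) cD)) λ ()) ,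
          (λ _ _ _ _ cD → contradiction (is at-commit (trans (unique n n₀ D) cD)) λ ()) ,
          (λ b j′ α′ _ cP _ _ _ ≢dig → contradiction (at-digit n cP) ≢dig) ,
          (λ b j′ α′ _ _ cP _ _ _ _ → agree w n e wG cP)
          where
          at-digit : ∀ {c b j′ α′} → NewTuple S a (G j) c → c P ≡ permit b j′ α′ → c (G j′) ≡ digit j′ α′
          at-digit n cP with refl ← is cP (trans (sym (unique n n₀ P)) at-permit) = new n
          agree : ∀ {c b j′ α′} w → NewTuple S a (G j) c → (∀ {X} → X ≢ G j → w X ≡ h (c X)) →
            w (G j) ≡ just β → c P ≡ permit b j′ α′ → w (G j′) ≡ w P
          agree w n e wG cP with refl ← is cP (trans (sym (unique n n₀ P)) at-permit) =
            trans wG (sym (trans (e λ ()) (trans (cong h cP) answer)))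

        -- Writing the digit spends the permit: every counter now attainable was covered by the
        -- permit bound `q`. As `D` holds `commit`, there is no `ask` and `r′` is arbitrary.
        digit-bounds : ∀ {p q r r′} → Bounds p q r S h → Bounds q q r′ (S ▷ a) (h [ a ↦ just β ])
        digit-bounds bd = record
          { total     = λ at → at-most (λ i j<i → above (at i) j<i) (on-digit (at j)) (λ i i<j → below (at i) i<j)
          ; permitted = λ
              { (inj₂ s) e at fj lower → permitted-only (only-permit s) (trans (sym (off s)) e)
                  (λ i j<i → at i j<i) fj lower }
          ; asked     = λ { (inj₂ s) → contradiction (is at-commit (sym (locate n₀ refl (inj₂ s)))) λ () } }
          where
          off : ∀ {v a′} → S a′ → (h [ a ↦ v ]) a′ ≡ h a′
          off {a′ = a′} = unchangedˢ {S} {h} {a} fresh {a′ = a′}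
          at-most : ∀ {f} → (∀ i → j Fin.< i → Attained S h i (f i)) → f j ≤ code α β →
            (∀ i → i Fin.< j → f i ≡ 0) → _ + value f ≤ L
          at-most = permitted bd (subst S at-permit (old n₀ λ ())) answer
          above : ∀ {i m} → Attained (S ▷ a) (h [ a ↦ just β ]) i m → j Fin.< i → Attained S h i m
          above none j<i = none
          above (some (inj₁ refl) e) j<i = contradiction j<i (ℕ.<-irrefl refl)
          above (some (inj₂ s) e) j<i = some s (trans (sym (off s)) e)
          on-digit : ∀ {m} → Attained (S ▷ a) (h [ a ↦ just β ]) j m → m ≤ code α β
          on-digit none = z≤n
          on-digit (some s e) with refl ← trans (locate n₀ refl s) (new n₀)
            with refl ← is (updated h a (just β)) e = ℕ.≤-refl
          below : ∀ {i m} → Attained (S ▷ a) (h [ a ↦ just β ]) i m → i Fin.< j → m ≡ 0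
          below none i<j = refl
          below (some (inj₁ refl) e) i<j = contradiction i<j (ℕ.<-irrefl refl)
          below {i} (some {α′} (inj₂ s) e) i<j = trans
            (cong (weight (digit i α′)) (sym (trans (sym (off s)) e)))
            (trans (cong (λ a → weight a (h a)) (locate n₀ refl (inj₂ s))) (zeros i i<j))
          permitted-only : ∀ {b j′ α′ β′ f} → permit b j′ α′ ≡ permit b₀ j α → h (permit b j′ α′) ≡ just β′ →
            (∀ i → j′ Fin.< i → Attained (S ▷ a) (h [ a ↦ just β ]) i (f i)) → f j′ ≤ code α′ β′ →
            (∀ i → i Fin.< j′ → f i ≡ 0) → _ + value f ≤ L
          permitted-only refl e at = permitted bd (subst S at-permit (old n₀ λ ())) e
            (λ i j<i → above (at i j<i) j<i)

  State : ℕ → ℕ → ℕ → Present → Response → Set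
  State p q r S h = Legality S h × Bounds p q r S h

  -- The responses in play when v bounds the logarithm of the number of
  -- quantifiers that Spoiler may still use.  After placing ask, two answers
  -- with different bits are kept; since a conjunction has one conjunct with
  -- at most half of the quantifiers, it suffices that each of them is
  -- winning at v and that one of them escapes at suc v.
  data Position (S : Present) : ℕ → Set where
    single : ∀ {v} h → State v v v S h → Position S v
    twin   : ∀ {v} (h : Fin 2 → Response) → (∀ b → State (suc v) v v S (h b)) → S ask →
             (∀ b → ∃[ z ] h b ask ≡ just z × bit z ≡ b) →
             ∀ b → Bounds (suc v) (suc v) v S (h b) → Position S (suc v)

  Index : ∀ {v S} → Position S v → Set
  Index (single _ _)     = ⊤
  Index (twin _ _ _ _ _ _) = Fin 2

  response : ∀ {v S} (p : Position S v) → Index p → Response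
  response (single h _)       _ = h
  response (twin h _ _ _ _ _) b = h b

  legality : ∀ {v S} (p : Position S v) i → Legality S (response p i)
  legality (single h st)       _ = proj₁ st
  legality (twin h st _ _ _ _) b = proj₁ (st b)

  infix 4 _refines_
  -- Each new answer function agrees with an earlier one on the old board, so that a win can be
  -- carried back across a quantifier.
  _refines_ : ∀ {v S S′} → Position S′ v → Position S v → Set
  _refines_ {S = S} p′ p = ∀ i′ → ∃[ i ] ∀ {a} → S a → response p′ i′ a ≡ response p i a

  -- When `ask` leaves the board, a twin collapses to its escaping branch, whose bound `r` is raised
  -- to that of a single position.
  restrict : ∀ {v S S′} → S ⊑ S′ → (p : Position S′ v) →
             DoubleNegation (Σ[ p′ ∈ Position S v ] ∀ i′ → ∃[ i ] response p′ i′ ≡ response p i)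
  restrict S⊑ (single h (leg , bd)) k =
    k (single h (restrict-legality S⊑ leg , restrict-bounds S⊑ bd) , λ i → i , refl)
  restrict S⊑ (twin h st s ans b bd) k = ¬¬-excluded-middle λ
    { (yes s′) → k (twin h (λ b → restrict-legality S⊑ (proj₁ (st b)) , restrict-bounds S⊑ (proj₂ (st b)))
                         s′ ans b (restrict-bounds S⊑ bd) , λ i → i , refl)
    ; (no ¬s′) → k (single (h b) (restrict-legality S⊑ (proj₁ (st b)) , forget-ask ¬s′ (restrict-bounds S⊑ bd)) ,
                    λ _ → b , refl) }

  Extension : ∀ {v S} → Position S v → Elem → Set
  Extension {v} {S} p a = Σ[ p′ ∈ Position (S ▷ a) v ] p′ refines p

  Quiet : Present → Elem → Response → Set
  Quiet S a h = ∃[ v ] Tame a v × Legality (S ▷ a) (h [ a ↦ v ])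

  private
    ¬¬-both : {A : Fin 2 → Set} → (∀ b → DoubleNegation (A b)) → DoubleNegation (∀ b → A b)
    ¬¬-both f k = f zero λ x → f (suc zero) λ y → k λ { zero → x ; (suc zero) → y }

    ≢-cover : ∀ (b : Fin 2) → ∃[ b′ ] b′ ≢ b
    ≢-cover zero       = suc zero , λ ()
    ≢-cover (suc zero) = zero , λ ()

  keep : ∀ S {a} h v → ¬ S a → ∀ {a′} → S a′ → (h [ a ↦ v ]) a′ ≡ h a′
  keep S {a} h v fresh {a′} = unchangedˢ {S} {h} {a} fresh {v} {a′}

  quiet-step : ∀ {v S a} (p : Position S v) → ¬ S a →
    (∀ i → DoubleNegation (Quiet S a (response p i))) → DoubleNegation (Extension p a)
  quiet-step {S = S} (single h (leg , bd)) fresh quiet k = quiet tt λ (v , tame , leg′) →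
    k (single _ (leg′ , tame-bounds fresh tame bd) , λ _ → tt , keep S h v fresh)
  quiet-step {S = S} (twin h st s ans b bd) fresh quiet k = ¬¬-both quiet λ q → k
    ( twin (λ b → _) (λ b → proj₂ (proj₂ (q b)) , tame-bounds fresh (proj₁ (proj₂ (q b))) (proj₂ (st b)))
        (inj₂ s) (λ b → let z , e , e′ = ans b in z , trans (keep S (h b) (proj₁ (q b)) fresh s) e , e′)
        b (tame-bounds fresh (proj₁ (proj₂ (q b))) bd)
    , λ b → b , keep S (h b) (proj₁ (q b)) fresh )

  raise : ∀ {p q q′ r S h} → (∀ {b j α} → S (permit b j α) → h (permit b j α) ≡ nothing) →
          Bounds p q r S h → Bounds p q′ r S h
  raise dead bd = record
    { total = total bd ; asked = asked bd
    ; permitted = λ s e → contradiction (trans (sym (dead s)) e) λ () }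

  module _ {v S} (p : Position S (suc v)) where

    token-step : ∀ {u} → DoubleNegation (Extension p (token u))
    token-step k = restrict (λ { () (inj₁ refl) ; _ (inj₂ s) → s }) p
      λ (p′ , f) → k (p′ , λ i′ → let i , e = f i′ in i , λ {a} _ → cong (λ h → h a) e)

    old-step : ∀ {a} → S a → DoubleNegation (Extension p a)
    old-step s k = restrict (λ { _ (inj₁ refl) → s ; _ (inj₂ s′) → s′ }) p
      λ (p′ , f) → k (p′ , λ i′ → let i , e = f i′ in i , λ {a} _ → cong (λ h → h a) e)

    select-step : ∀ {X} → ¬ S (select X) → Small (S ▷ select X) → ∃[ z ] ¬ S (clear X z) →
                  DoubleNegation (Extension p (select X))
    select-step fresh small (z , ¬s) = quiet-step p fresh λ i k →
      k (just z , tt , Moves.select-live (legality p i) fresh small ¬s)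

    clear-step : ∀ {X z} → ¬ S (clear X z) → Small (S ▷ clear X z) → DoubleNegation (Extension p (clear X z))
    clear-step fresh small = quiet-step p fresh λ i k → ¬¬-excluded-middle λ
      { (yes s) → k (just zero , tt , Moves.clear-live (legality p i) fresh small s)
      ; (no ¬s) → k (nothing , tt , Moves.clear-dead (legality p i) fresh small (λ s → contradiction s ¬s)) }

    commit-step : ¬ S commit → Small (S ▷ commit) → DoubleNegation (Extension p commit)
    commit-step fresh small = quiet-step p fresh λ i k → ¬¬-excluded-middle λ
      { (yes forced) → k (just zero , tt , Moves.commit-live (legality p i) fresh small forced)
      ; (no ¬forced) → k (nothing , tt , Moves.commit-dead (legality p i) fresh small ¬forced) }

  ask-step : ∀ {v S} (p : Position S (suc v)) → ¬ S ask → Small (S ▷ ask) → DoubleNegation (Extension p ask)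
  ask-step (twin _ _ s _ _ _) fresh small k = fresh s
  ask-step {v} {S} p@(single h st@(leg , bd)) fresh small k = ¬¬-excluded-middle λ
    { (no ¬forced) → quiet-step p fresh (λ _ k → k (nothing , refl , ask-dead fresh small ¬forced)) k
    ; (yes forced) → k
        ( twin (λ b → h [ ask ↦ just (unbit b) ])
            (λ b → ask-live fresh small bd forced (unbit b) , weaken ℕ.≤-refl (ℕ.n≤1+n v) ℕ.≤-refl (bounds (unbit b)))
            (inj₁ refl) (λ b → unbit b , updated h ask _ , bit-unbit b) zero (bounds zero)
        , λ b → tt , keep S h _ fresh ) }
    where
    open Moves leg
    bounds : ∀ z → Bounds (suc v) (suc v) v (S ▷ ask) (h [ ask ↦ just z ])
    bounds z = record
      { total     = λ at → total bd (λ i → drop (at i))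
      ; permitted = λ { (inj₂ s) e at → permitted bd s (trans (sym (keep S h _ fresh s)) e) (λ i j<i → drop (at i j<i)) }
      -- The `suc v` advances left for the counter are one for this `ask` and `v` after it.
      ; asked     = λ _ _ at → total bd (λ i → drop (at i)) }
      where
      drop : ∀ {i m} → Attained (S ▷ ask) (h [ ask ↦ just z ]) i m → Attained S h i m
      drop = drop-attained fresh λ ()

  -- In a twin position only the branch with bit `b` can be forced to honour the permit. The other
  -- branch answers `nothing`; its permit bound is then vacuous, and it becomes the escaping branch.
  permit-step : ∀ {v S b j α} (p : Position S (suc v)) → ¬ S (permit b j α) → Small (S ▷ permit b j α) →
                DoubleNegation (Extension p (permit b j α))
  permit-step {S = S} p@(single h (leg , bd)) fresh small k = ¬¬-excluded-middle λ
    { (no ¬forced) → quiet-step p fresh (λ _ k → k (nothing , refl , permit-dead fresh small ¬forced)) k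
    ; (yes forced) → k (single _ (permit-live fresh small forced , permit-bounds fresh small forced bd) ,
                        λ _ → tt , keep S h _ fresh) }
    where open Moves leg
  permit-step {v} {S} {b} {j} {α} p@(twin h st s ans _ _) fresh small k = ¬¬-excluded-middle λ
    { (no ¬forced) → quiet-step p fresh (λ b′ k → k (nothing , refl , dead ¬forced b′)) k
    ; (yes forced) → k (answer-b forced) }
    where
    module At b = Moves (proj₁ (st b))
    Forced : Fin 2 → Set
    Forced b′ = At.PermitForced b′ fresh small
    unforced : ∀ {b′} → b′ ≢ b → ¬ Forced b′
    unforced {b′} b′≢b forced with z , e , refl ← ans b′ with refl ← trans (sym e) (At.PermitForced.answer forced) =
      b′≢b (At.PermitForced.same-bit forced)
    dead : ¬ Forced b → ∀ b′ → Legality (S ▷ permit b j α) (h b′ [ permit b j α ↦ nothing ])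
    dead ¬forced b′ with b′ ≟ b
    ... | yes refl = At.permit-dead b fresh small ¬forced
    ... | no b′≢b  = At.permit-dead b′ fresh small (unforced b′≢b)
    answer-b : Forced b → Extension p (permit b j α)
    answer-b forced = twin (λ b′ → h b′ [ permit b j α ↦ u b′ ]) state (inj₂ s)
        (λ b′ → let z , e , e′ = ans b′ in z , trans (keep S (h b′) (u b′) fresh s) e , e′)
        b̄ other-bounds , λ b′ → b′ , keep S (h b′) (u b′) fresh
      where
      u : Fin 2 → Value
      u b′ with b′ ≟ b
      ... | yes _ = just (At.PermitForced.β forced)
      ... | no  _ = nothing
      state : ∀ b′ → State (suc v) v v (S ▷ permit b j α) (h b′ [ permit b j α ↦ u b′ ])
      state b′ with b′ ≟ b
      ... | yes refl = At.permit-live b fresh small forced , At.permit-bounds b fresh small forced (proj₂ (st b))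
      ... | no b′≢b  = At.permit-dead b′ fresh small (unforced b′≢b) , tame-bounds fresh refl (proj₂ (st b′))
      b̄ : Fin 2
      b̄ = proj₁ (≢-cover b)
      u-other : u b̄ ≡ nothing
      u-other with b̄ ≟ b
      ... | yes eq = contradiction eq (proj₂ (≢-cover b))
      ... | no  _  = refl
      open NewTuples {S} {h b} {permit b j α} {P} refl fresh small
      other-bounds : Bounds (suc v) (suc v) v (S ▷ permit b j α) (h b̄ [ permit b j α ↦ u b̄ ])
      other-bounds = raise all-dead (proj₂ (state b̄))
        where
        n₀ = At.PermitForced.tuple forced
        all-dead : ∀ {b′ j′ α′} → (S ▷ permit b j α) (permit b′ j′ α′) →
                   (h b̄ [ permit b j α ↦ u b̄ ]) (permit b′ j′ α′) ≡ nothing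
        all-dead s with refl ← trans (locate n₀ refl s) (NewTuple.new n₀) = trans (updated (h b̄) _ _) u-other

  digit-step : ∀ {v S j α} (p : Position S (suc v)) → ¬ S (digit j α) → Small (S ▷ digit j α) →
               DoubleNegation (Extension p (digit j α))
  digit-step {S = S} p@(single h (leg , bd)) fresh small k = ¬¬-excluded-middle λ
    { (no ¬forced) → quiet-step p fresh (λ _ k → k (nothing , refl , digit-dead fresh small ¬forced)) k
    ; (yes forced) → k (single _ (digit-live fresh small forced , digit-bounds fresh small forced bd) ,
                        λ _ → tt , keep S h _ fresh) }
    where open Moves leg
  digit-step {S = S} {j} {α} p@(twin h st s ans _ _) fresh small =
    quiet-step p fresh λ b k → k (nothing , refl , Moves.digit-dead (proj₁ (st b)) fresh small unforced)
    where
    -- The `ask` of a twin position would be the entry at `D`, where a forced digit needs `commit`.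
    unforced : ∀ {b} → ¬ Moves.DigitForced (proj₁ (st b)) fresh small
    unforced {b} forced = contradiction (trans (locate tuple refl (inj₂ s)) at-commit) λ ()
      where
      open Moves.DigitForced forced using (tuple; at-commit)
      open NewTuples {S} {h b} {digit j α} {G j} refl fresh small

  step : ∀ {v S} (p : Position S (suc v)) a → Small (S ▷ a) → (∀ X → ∃[ z ] ¬ S (clear X z)) →
         DoubleNegation (Extension p a)
  step {S = S} p a small free k = ¬¬-excluded-middle λ
    { (yes s)    → old-step p s k
    ; (no fresh) → go a small fresh k }
    where
    go : ∀ a → Small (S ▷ a) → ¬ S a → DoubleNegation (Extension p a)
    go (token u)      _     _     = token-step p
    go (select X)     small fresh = select-step p fresh small (free X)
    go ask            small fresh = ask-step p fresh small
    go commit         small fresh = commit-step p fresh small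
    go (clear X z)    small fresh = clear-step p fresh small
    go (permit b j α) small fresh = permit-step p fresh small
    go (digit j α)    small fresh = digit-step p fresh small

-- Finite maps and the semantics of existential-positive formulas.

lookup-injective : ∀ {A : Set} {n} {xs ys : Vec A n} → (∀ i → lookup xs i ≡ lookup ys i) → xs ≡ ys
lookup-injective {xs = xs} {ys} eq =
  trans (sym (Vec.tabulate∘lookup xs)) (trans (Vec.tabulate-cong eq) (Vec.tabulate∘lookup ys))

map-cong-∈ : ∀ {A B : Set} {f g : A → B} {n} (xs : Vec A n) →
             (∀ {x} → x ∈ xs → f x ≡ g x) → map f xs ≡ map g xs
map-cong-∈ []       eq = refl
map-cong-∈ (x ∷ xs) eq = cong₂ _∷_ (eq (here refl)) (map-cong-∈ xs (eq ∘ there))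

map-lookup : ∀ {A B : Set} {m n} (f : A → B) (s : Vec A n) (xs : Vec (Fin n) m) →
             map f (map (lookup s) xs) ≡ map (lookup (map f s)) xs
map-lookup f s xs = trans (sym (Vec.map-∘ f (lookup s) xs)) (Vec.map-cong (λ x → sym (Vec.lookup-map x f s)) xs)

injective⇒surjective : ∀ {n} (f : Fin n → Fin n) → Injective _≡_ _≡_ f → ∀ y → ∃[ x ] f x ≡ y
injective⇒surjective {suc n} f inj y with any? (λ x → f x ≟ y)
... | yes hit = hit
... | no miss = contradiction
  (injective⇒≤ {f = λ x → punchOut (avoid x)} (λ eq → inj (punchOut-injective (avoid _) (avoid _) eq)))
  ℕ.1+n≰n
  where
  avoid : ∀ x → y ≢ f x
  avoid x eq = miss (x , sym eq)

module _ {σ : Signature} {k : ℕ} where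

  module _ {n} (A : Structure σ n) where

    satisfies? : ∀ s (φ : ∃⁺L σ k) → Dec (A , s ⊩ φ)
    satisfies? s (rel R xs) = T? _
    satisfies? s (x ≐ y)    = lookup s x ≟ lookup s y
    satisfies? s (φ ∧ ψ)    = satisfies? s φ ×-dec satisfies? s ψ
    satisfies? s (φ ∨ ψ)    = satisfies? s φ ⊎-dec satisfies? s ψ
    satisfies? s (ex x φ)   = any? λ a → satisfies? (s [ x ]≔ a) φ

    coincidence : ∀ {s s′} (φ : ∃⁺L σ k) → (∀ {z} → z FreeIn φ → lookup s z ≡ lookup s′ z) →
                  A , s ⊩ φ → A , s′ ⊩ φ
    coincidence (rel R xs) eq = subst (T ∘ Structure.interp A R) (map-cong-∈ xs eq)
    coincidence (x ≐ y)    eq e = trans (sym (eq (inj₁ refl))) (trans e (eq (inj₂ refl)))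
    coincidence (φ ∧ ψ)    eq = Product.map (coincidence φ (eq ∘ inj₁)) (coincidence ψ (eq ∘ inj₂))
    coincidence (φ ∨ ψ)    eq = Sum.map (coincidence φ (eq ∘ inj₁)) (coincidence ψ (eq ∘ inj₂))
    coincidence {s} {s′} (ex x φ) eq (a , sat) = a , coincidence φ eq′ sat
      where
      eq′ : ∀ {z} → z FreeIn φ → lookup (s [ x ]≔ a) z ≡ lookup (s′ [ x ]≔ a) z
      eq′ {z} free with z ≟ x
      ... | yes refl = trans (Vec.lookup∘update x s a) (sym (Vec.lookup∘update x s′ a))
      ... | no z≢x   = trans (Vec.lookup∘update′ z≢x s a)
                         (trans (eq (z≢x , free)) (sym (Vec.lookup∘update′ z≢x s′ a)))

    sentence-irrelevant : ∀ {φ : ∃⁺L σ k} → Sentence φ → ∀ {s} s′ → A , s ⊩ φ → A , s′ ⊩ φ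
    sentence-irrelevant {φ} sen s′ = coincidence φ (λ {z} free → contradiction free (sen z))

  homomorphism-preserves : ∀ {m n} {B : Structure σ m} {A : Structure σ n} (f : Fin m → Fin n) →
    (∀ R ys → T (Structure.interp B R ys) → T (Structure.interp A R (map f ys))) →
    ∀ s (φ : ∃⁺L σ k) → B , s ⊩ φ → A , map f s ⊩ φ
  homomorphism-preserves {B = B} {A} f hom = preserves
    where
    preserves : ∀ s (φ : ∃⁺L σ k) → B , s ⊩ φ → A , map f s ⊩ φ
    preserves s (rel R xs) t = subst (T ∘ Structure.interp A R) (map-lookup f s xs) (hom R _ t)
    preserves s (x ≐ y)    e = trans (Vec.lookup-map x f s) (trans (cong f e) (sym (Vec.lookup-map y f s)))
    preserves s (φ ∧ ψ)      = Product.map (preserves s φ) (preserves s ψ)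
    preserves s (φ ∨ ψ)      = Sum.map (preserves s φ) (preserves s ψ)
    preserves s (ex x φ) (a , sat) =
      f a , subst (λ s → A , s ⊩ φ) (Vec.map-[]≔ f s x) (preserves (s [ x ]≔ a) φ sat)

half-power : ∀ v {m n} → m + n < 2 ^ suc v → m < 2 ^ v ⊎ n < 2 ^ v
half-power v {m} {n} lt with m ℕ.<? 2 ^ v | n ℕ.<? 2 ^ v
... | yes m< | _      = inj₁ m<
... | no _   | yes n< = inj₂ n<
... | no m≮  | no n≮  = contradiction lt (ℕ.≤⇒≯ (ℕ.+-mono-≤ (ℕ.≮⇒≥ m≮)
                          (subst (_≤ n) (sym (ℕ.+-identityʳ (2 ^ v))) (ℕ.≮⇒≥ n≮))))

-- Agreement on sentences with few quantifiers.

module Play (d M n : ℕ) (decode : Fin n → Elements.Elem d M)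
  (encode : Elements.Elem d M → Fin n) (decode-encode : ∀ a → decode (encode a) ≡ a) where

  open Elements d M
  open Structures d M n decode encode decode-encode
  open Duplicator d M
  open Legality

  write : Value → Fin n
  write u = encode (token u)

  read-write : ∀ u → read (write u) ≡ u
  read-write u = cong valueOf (decode-encode (token u))

  ℬ⇒𝒜 : ∀ s (φ : ∃⁺L σ k) → ℬ , s ⊩ φ → 𝒜 , map (write ∘ read) s ⊩ φ
  ℬ⇒𝒜 = homomorphism-preserves {B = ℬ} {A = 𝒜} (write ∘ read) λ R ys t →
    fromWitness (inj₂ (tokens-only ys ,
      subst (LegalVec (pattern-of R)) (sym (values ys)) (toWitness t)))
    where
    values : ∀ ys → map valueOf (map decode (map (write ∘ read) ys)) ≡ map read ys
    values ys = trans (sym (Vec.map-∘ valueOf decode (map (write ∘ read) ys)))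
      (trans (sym (Vec.map-∘ (valueOf ∘ decode) (write ∘ read) ys)) (Vec.map-cong (λ y → read-write (read y)) ys))
    tokens-only : ∀ ys → let t = map decode (map (write ∘ read) ys) in t ≡ map token (map valueOf t)
    tokens-only ys = trans (sym (Vec.map-∘ decode (write ∘ read) ys)) (trans
      (Vec.map-cong (λ y → decode-encode (token (read y))) ys)
      (trans (Vec.map-∘ token read ys) (cong (map token) (sym (values ys)))))

  On : Vec (Fin n) k → Present
  On s a = ∃[ x ] decode (lookup s x) ≡ a

  Off : Vec (Fin n) k → Fin k → Present
  Off s x a = ∃[ y ] y ≢ x × decode (lookup s y) ≡ a

  Off⊑On : ∀ {s x} → Off s x ⊑ On s
  Off⊑On _ (y , _ , e) = y , e

  on-update : ∀ {s x b a} → On (s [ x ]≔ b) a → (Off s x ▷ decode b) a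
  on-update {s} {x} {b} (y , e) with y ≟ x
  ... | yes refl = inj₁ (trans (sym e) (cong decode (Vec.lookup∘update x s b)))
  ... | no y≢x   = inj₂ (y , y≢x , trans (cong decode (sym (Vec.lookup∘update′ y≢x s b))) e)

  update-on : ∀ {s x b a} → (Off s x ▷ decode b) a → On (s [ x ]≔ b) a
  update-on {s} {x} {b} (inj₁ refl) = x , cong decode (Vec.lookup∘update x s b)
  update-on {s} {x} {b} (inj₂ (y , y≢x , e)) = y , trans (cong decode (Vec.lookup∘update′ y≢x s b)) e

  -- The `k` entries of a colored tuple have distinct colours, hence lie on distinct variables, and
  -- these are all the variables.
  small-on : ∀ s → Small (On s)
  small-on s {c} col on (x , refl) with injective⇒surjective π π-injective x
    where
    π : Fin k → Fin k
    π X = proj₁ (on X)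
    π-injective : ∀ {X Y} → π X ≡ π Y → X ≡ Y
    π-injective {X} {Y} eq = just-injective (trans (sym (col X)) (trans
      (cong color (trans (sym (proj₂ (on X))) (trans (cong (decode ∘ lookup s) eq) (proj₂ (on Y))))) (col Y)))
  ... | X , refl = X , proj₂ (on X)

  small-update : ∀ s x b → Small (Off s x ▷ decode b)
  small-update s x b col in-S a∈S = small-on (s [ x ]≔ b) col (λ X → update-on {s} (in-S X)) (update-on {s} a∈S)

  free-clear : ∀ s x X → ∃[ z ] ¬ Off s x (clear X z)
  free-clear s x X with ¬∀⟶∃¬ N (λ z → On s (clear X z)) (λ z → any? λ y → decode (lookup s y) ≟ᵉ clear X z) crowded
    where
    crowded : ¬ (∀ z → On s (clear X z))
    crowded all with pigeonhole (s≤s (s≤s (ℕ.≤-trans (ℕ.m≤m+n (suc d) M) ℕ.≤-refl))) (proj₁ ∘ all)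
    ... | i , j , i<j , eq with refl ← trans (sym (proj₂ (all i))) (trans (cong (decode ∘ lookup s) eq) (proj₂ (all j)))
      = ℕ.<-irrefl refl i<j
  ... | z , free = z , λ (y , _ , e) → free (y , e)

  respond : Response → Vec (Fin n) k → Vec (Fin n) k
  respond h = map (write ∘ h ∘ decode)

  legality⇒legal : ∀ {S h c w} → Legality S h → (∀ X → S (c X)) → (∀ X → w X ≡ h (c X)) → Legal c w
  legality⇒legal {S} {h} {c} {w} leg c∈S w≡ =
    (λ X e wD → selected leg (subst S e (c∈S D)) (trans (sym (val e)) wD)) ,
    (λ X z e wD e′ wX → cleared leg (subst S e (c∈S D)) (trans (sym (val e)) wD) (subst S e′ (c∈S (suc X)))
                          (trans (sym (val e′)) wX)) ,
    (λ col → full leg col c∈S w≡)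
    where
    val : ∀ {X a} → c X ≡ a → w X ≡ h a
    val {X} e = trans (w≡ X) (cong h e)

  Wins : ∀ {v S} → Position S v → Vec (Fin n) k → ∃⁺L σ k → Set
  Wins p s φ = ∃[ i ] ℬ , respond (response p i) s ⊩ φ

  read-respond : ∀ h s {m} (xs : Vec (Fin k) m) →
    map read (map (lookup (respond h s)) xs) ≡ map h (map decode (map (lookup s) xs))
  read-respond h s xs = begin
    map read (map (lookup (respond h s)) xs)            ≡⟨ cong (map read) (map-lookup (write ∘ h ∘ decode) s xs) ⟨
    map read (map (write ∘ h ∘ decode) (map (lookup s) xs)) ≡⟨ Vec.map-∘ read (write ∘ h ∘ decode) (map (lookup s) xs) ⟨
    map (read ∘ write ∘ h ∘ decode) (map (lookup s) xs) ≡⟨ Vec.map-cong (λ x → read-write (h (decode x))) (map (lookup s) xs) ⟩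
    map (h ∘ decode) (map (lookup s) xs)                ≡⟨ Vec.map-∘ h decode (map (lookup s) xs) ⟩
    map h (map decode (map (lookup s) xs))              ∎
    where open ≡-Reasoning

  -- A fact of `𝒜` holds either at its own pattern, where legality of the answers gives the fact in
  -- `ℬ`, or at a legal tuple of tokens, which are answered by their own values.
  atom : ∀ {s h} → Legality (On s) h → ∀ R xs → 𝒜 , s ⊩ rel R xs → ℬ , respond h s ⊩ rel R xs
  atom {s} {h} leg R xs t = fromWitness (subst (LegalVec (pattern-of R)) (sym (read-respond h s xs))
    (legal (map decode (map (lookup s) xs)) (λ X → lookup xs X , sym (at X)) (toWitness t)))
    where
    at : ∀ X → lookup (map decode (map (lookup s) xs)) X ≡ decode (lookup s (lookup xs X))
    at X = trans (Vec.lookup-map X decode (map (lookup s) xs)) (cong decode (Vec.lookup-map X (lookup s) xs))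
    legal : ∀ {c} t → (∀ X → On s (lookup t X)) → InA c t → LegalVec c (map h t)
    legal t on (inj₁ refl) = legality⇒legal leg on (λ X → Vec.lookup-map X h t)
    legal {c} t on (inj₂ (eq , leg′)) = subst (LegalVec c) (sym (begin
      map h t                         ≡⟨ cong (map h) eq ⟩
      map h (map token (map valueOf t)) ≡⟨ Vec.map-∘ h token (map valueOf t) ⟨
      map (h ∘ token) (map valueOf t) ≡⟨ Vec.map-cong (tokens leg) (map valueOf t) ⟩
      map id (map valueOf t)          ≡⟨ Vec.map-id (map valueOf t) ⟩
      map valueOf t                   ∎)) leg′
      where open ≡-Reasoning

  some-index : ∀ {v S} (p : Position S v) → Index p
  some-index (single _ _)         = tt
  some-index (twin _ _ _ _ _ _) = zero

  -- Induction on the formula; it is enough that one branch wins. For a conjunction in a twin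
  -- position, the twin is kept for one conjunct, and the branch that wins there is used alone for
  -- the other, which has fewer than `2 ^ v` quantifiers.
  play : ∀ {v s} (p : Position (On s) v) φ → #quantifiers φ < 2 ^ v → 𝒜 , s ⊩ φ → DoubleNegation (Wins p s φ)
  play {s = s} p (rel R xs) lt sat k = k (some-index p , atom {s} (legality p _) R xs sat)
  play {s = s} p (x ≐ y) lt eq k = k (some-index p ,
    trans (Vec.lookup-map x f s) (trans (cong f eq) (sym (Vec.lookup-map y f s))))
    where
    f : Fin n → Fin n
    f = write ∘ response p (some-index p) ∘ decode
  play p@(single _ _) (φ ∧ ψ) lt (satφ , satψ) k =
    play p φ (ℕ.≤-<-trans (ℕ.m≤m+n _ _) lt) satφ λ (_ , winφ) →
    play p ψ (ℕ.≤-<-trans (ℕ.m≤n+m _ _) lt) satψ λ (_ , winψ) → k (tt , winφ , winψ)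
  play {suc v} p@(twin h st _ _ _ _) (φ ∧ ψ) lt (satφ , satψ) k with half-power v lt
  ... | inj₁ φ< =
    play p ψ (ℕ.≤-<-trans (ℕ.m≤n+m _ _) lt) satψ λ (b , winψ) →
    play (half b) φ φ< satφ λ (_ , winφ) → k (b , winφ , winψ)
    where
    half : ∀ b → Position _ v
    half b = single (h b) (proj₁ (st b) , weaken (ℕ.n≤1+n v) ℕ.≤-refl ℕ.≤-refl (proj₂ (st b)))
  ... | inj₂ ψ< =
    play p φ (ℕ.≤-<-trans (ℕ.m≤m+n _ _) lt) satφ λ (b , winφ) →
    play (half b) ψ ψ< satψ λ (_ , winψ) → k (b , winφ , winψ)
    where
    half : ∀ b → Position _ v
    half b = single (h b) (proj₁ (st b) , weaken (ℕ.n≤1+n v) ℕ.≤-refl ℕ.≤-refl (proj₂ (st b)))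
  play p (φ ∨ ψ) lt (inj₁ sat) k =
    play p φ (ℕ.≤-<-trans (ℕ.m≤m+n _ _) lt) sat λ (i , win) → k (i , inj₁ win)
  play p (φ ∨ ψ) lt (inj₂ sat) k =
    play p ψ (ℕ.≤-<-trans (ℕ.m≤n+m _ _) lt) sat λ (i , win) → k (i , inj₂ win)
  play {zero} p (ex x φ) (s≤s ()) sat k
  play {suc v} {s} p (ex x φ) lt (a , sat) k =
    -- The element on `x` is lifted before `a` is placed, so answers have to persist only on the
    -- remaining variables.
    restrict (Off⊑On {s}) p λ (p₁ , f₁) →
    step p₁ (decode a) (small-update s x a) (free-clear s x) λ (p₂ , f₂) →
    restrict (λ _ → on-update {s}) p₂ λ (p₃ , f₃) →
    play p₃ φ (ℕ.<-trans (ℕ.n<1+n _) lt) sat λ (i₃ , win) →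
      let i₂ , e₃ = f₃ i₃ ; i₁ , e₂ = f₂ i₂ ; i , e₁ = f₁ i₁ in
      k (i , write (response p₃ i₃ (decode a)) , subst (λ y → ℬ , y ⊩ φ)
        (agree (response p₃ i₃) (response p i) λ off →
          trans (cong (λ h → h _) e₃) (trans (e₂ off) (cong (λ h → h _) e₁))) win)
    where
    agree : ∀ h′ h → (∀ {b} → Off s x b → h′ b ≡ h b) →
      respond h′ (s [ x ]≔ a) ≡ respond h s [ x ]≔ write (h′ (decode a))
    agree h′ h eq = trans (Vec.map-[]≔ (write ∘ h′ ∘ decode) s x) (lookup-injective at)
      where
      b : Fin n
      b = write (h′ (decode a))
      at : ∀ y → lookup (respond h′ s [ x ]≔ b) y ≡ lookup (respond h s [ x ]≔ b) y
      at y with y ≟ x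
      ... | yes refl = trans (Vec.lookup∘update x (respond h′ s) b) (sym (Vec.lookup∘update x (respond h s) b))
      ... | no y≢x   = begin
        lookup (respond h′ s [ x ]≔ b) y ≡⟨ Vec.lookup∘update′ y≢x (respond h′ s) b ⟩
        lookup (respond h′ s) y          ≡⟨ Vec.lookup-map y _ s ⟩
        write (h′ (decode (lookup s y))) ≡⟨ cong write (eq (y , y≢x , refl)) ⟩
        write (h (decode (lookup s y)))  ≡⟨ Vec.lookup-map y _ s ⟨
        lookup (respond h s) y           ≡⟨ Vec.lookup∘update′ y≢x (respond h s) b ⟨
        lookup (respond h s [ x ]≔ b) y  ∎
        where open ≡-Reasoning

  blank : Vec (Fin n) k
  blank = replicate k (write nothing)

  -- A board of void tokens stores the counter 0, which leaves all `L` advances.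
  start : Position (On blank) L
  start = single valueOf (legal , bounds)
    where
    none-on : ∀ {a X} → color a ≡ just X → ¬ On blank a
    none-on {a} {X} col (x , e) = contradiction (trans (sym col) (cong color (trans (sym e)
      (trans (cong decode (Vec.lookup-replicate x (write nothing))) (decode-encode _))))) λ ()
    legal : Legality (On blank) valueOf
    legal = record
      { tokens   = λ _ → refl
      ; selected = λ on → contradiction on (none-on refl)
      ; cleared  = λ on → contradiction on (none-on refl)
      ; full     = λ col on → contradiction (on D) (none-on (col D)) }
    zero-value : ∀ d → value {d} (λ _ → 0) ≡ 0
    zero-value zero    = refl
    zero-value (suc d) = trans (cong (suc Q *_) (zero-value d)) (ℕ.*-zeroʳ (suc Q))
    attained-zero : ∀ {i m} → Attained (On blank) valueOf i m → m ≤ 0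
    attained-zero none        = z≤n
    attained-zero (some on _) = contradiction on (none-on refl)
    bounds : Bounds L L L (On blank) valueOf
    bounds = record
      { total     = λ at → ℕ.≤-trans
          (ℕ.+-monoʳ-≤ L (ℕ.≤-trans (value-mono (λ i → attained-zero (at i))) (ℕ.≤-reflexive (zero-value d))))
          (ℕ.≤-reflexive (ℕ.+-identityʳ L))
      ; permitted = λ on → contradiction on (none-on refl)
      ; asked     = λ on → contradiction on (none-on refl) }

  agree : ∀ φ → Sentence φ → #quantifiers φ < 2 ^ L → AgreeOn 𝒜 ℬ φ
  agree φ sen lt = record
    -- Satisfaction in a finite structure is decidable, which removes the double negation.
    { to   = λ sat s → decidable-stable (satisfies? ℬ s φ) λ k →
        play start φ lt (sat blank) λ (_ , win) → k (sentence-irrelevant ℬ {φ} sen s win)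
    ; from = λ sat s → sentence-irrelevant 𝒜 {φ} sen s (ℬ⇒𝒜 blank φ (sat blank))
    ; to-cong = λ { refl → refl } ; from-cong = λ { refl → refl } }

-- Spoiler's strategy.

least-failure : ∀ {n} {A : Fin n → Set} → Decidable A → ¬ (∀ i → A i) →
                ∃[ j ] ¬ A j × (∀ i → i Fin.< j → A i)
least-failure {zero}  A? ¬all = contradiction (λ ()) ¬all
least-failure {suc n} A? ¬all with A? zero
... | no ¬a = zero , ¬a , λ _ ()
... | yes a with j , ¬aj , below ← least-failure (A? ∘ suc) (λ all → ¬all λ { zero → a ; (suc i) → all i }) =
  suc j , ¬aj , λ { zero _ → a ; (suc i) (s≤s i<j) → below i i<j }

module Spoiler (d M : ℕ) where
  open Elements d M

  Board : Set
  Board = Vec Elem k × Vec Value k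

  infix 9 _!_
  _!_ : Board → Color → Elem × Value
  (c , w) ! X = lookup c X , lookup w X

  LegalBoard : Board → Set
  LegalBoard (c , w) = Legal (lookup c) (lookup w)

  data Win (b : Board) : Set where
    illegal : ¬ LegalBoard b → Win b
    move    : ∀ X a → (∀ r → Win (proj₁ b [ X ]≔ a , proj₂ b [ X ]≔ r)) → Win b

  place : ∀ {b} X a →
    (∀ b′ → proj₁ (b′ ! X) ≡ a → (∀ {Y} → Y ≢ X → b′ ! Y ≡ b ! Y) → LegalBoard b′ → Win b′) → Win b
  place {c , w} X a win = move X a λ r → respond r (legal? (lookup (c [ X ]≔ a)) (lookup (w [ X ]≔ r)))
    where
    respond : ∀ r → Dec (LegalBoard (c [ X ]≔ a , w [ X ]≔ r)) → Win (c [ X ]≔ a , w [ X ]≔ r)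
    respond r (no ¬legal) = illegal ¬legal
    respond r (yes legal) = win _ (Vec.lookup∘update X c a)
      (λ Y≢X → cong₂ _,_ (Vec.lookup∘update′ Y≢X c a) (Vec.lookup∘update′ Y≢X w r)) legal

  LiveCell : Elem × Value → Set
  LiveCell (a , r) = r ≢ nothing

  ClearCell : Fin (suc d) → Elem × Value → Set
  ClearCell X (a , r) = ∃[ z ] a ≡ clear X z × r ≢ nothing

  DigitCell : Fin d → Elem × Value → Set
  DigitCell i (a , r) = color a ≡ just (G i) × r ≢ nothing

  -- `SelectRule` extracts some `z`, and `ClearRule` then forces a live answer to `clear X z`. The
  -- price is the former content of `D`.
  place-clear : ∀ {b} X →
    (∀ b′ → ClearCell X (b′ ! suc X) → (∀ {Y} → Y ≢ D → Y ≢ suc X → b′ ! Y ≡ b ! Y) → Win b′) → Win b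
  place-clear {b} X win = place D (select X) λ b₁ cD same₁ legal₁ → answered b₁ cD same₁ legal₁ _ refl
    where
    answered : ∀ b₁ → proj₁ (b₁ ! D) ≡ select X → (∀ {Y} → Y ≢ D → b₁ ! Y ≡ b ! Y) → LegalBoard b₁ →
               ∀ r → proj₂ (b₁ ! D) ≡ r → Win b₁
    answered b₁ cD same₁ (sel , _) nothing  e = contradiction e (sel X cD)
    answered b₁ cD same₁ _         (just z) e = place (suc X) (clear X z) λ b₂ cX same₂ (_ , clr , _) →
      win b₂ (z , cX , clr X z (trans (cong proj₁ (same₂ λ ())) cD) (trans (cong proj₂ (same₂ λ ())) e) cX)
        (λ Y≢D Y≢X → trans (same₂ Y≢X) (same₁ Y≢D))

  record Reset (m : ℕ) (b b′ : Board) : Set where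
    field
      cleared : ∀ i → toℕ i < m → ClearCell (suc i) (b′ ! G i)
      kept    : ∀ {Y} → Y ≢ D → (∀ i → toℕ i < m → Y ≢ G i) → b′ ! Y ≡ b ! Y
  open Reset

  reset : ∀ {b} m → m ≤ d → (∀ b′ → Reset m b b′ → Win b′) → Win b
  reset zero    m≤d win = win _ record { cleared = λ _ () ; kept = λ _ _ → refl }
  reset {b} (suc m) m<d win = reset m (ℕ.<⇒≤ m<d) λ b₁ r₁ →
    place-clear (suc i₀) λ b₂ cell same → win b₂ record
      { cleared = λ i i≤m → cleared′ {b₁} {b₂} r₁ cell same i (i ≟ i₀) i≤m
      ; kept    = λ Y≢D Y≢G → trans (same Y≢D (Y≢G i₀ (s≤s (ℕ.≤-reflexive (toℕ-fromℕ< m<d)))))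
                                    (kept r₁ Y≢D λ i i<m → Y≢G i (ℕ.m<n⇒m<1+n i<m)) }
    where
    i₀ : Fin d
    i₀ = fromℕ< m<d
    cleared′ : ∀ {b₁ b₂} → Reset m b b₁ → ClearCell (suc i₀) (b₂ ! G i₀) →
      (∀ {Y} → Y ≢ D → Y ≢ G i₀ → b₂ ! Y ≡ b₁ ! Y) →
      ∀ i → Dec (i ≡ i₀) → toℕ i < suc m → ClearCell (suc i) (b₂ ! G i)
    cleared′ r₁ cell same i (yes refl) _         = cell
    cleared′ r₁ cell same i (no i≢i₀)  (s≤s i≤m) = subst (ClearCell (suc i)) (sym (same (λ ()) λ { refl → i≢i₀ refl }))
      (cleared r₁ i (ℕ.≤∧≢⇒< i≤m λ e → i≢i₀ (toℕ-injective (trans e (sym (toℕ-fromℕ< m<d))))))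

  Digits : Board → Set
  Digits b = ∀ i → DigitCell i (b ! G i)

  weights : Board → Fin d → ℕ
  weights b i = uncurry weight (b ! G i)

  weight≤Q : ∀ a r → weight a r ≤ Q
  weight≤Q (digit i α)    (just β) = code≤ α β
  weight≤Q (digit i α)    nothing  = z≤n
  weight≤Q (token v)      r        = z≤n
  weight≤Q (select X)     r        = z≤n
  weight≤Q ask            r        = z≤n
  weight≤Q commit         r        = z≤n
  weight≤Q (clear X z)    r        = z≤n
  weight≤Q (permit b j α) r        = z≤n

  clear⇒digit : ∀ {i cell} → ClearCell (suc i) cell → DigitCell i cell
  clear⇒digit (z , refl , live) = refl , live

  clear⇒zero : ∀ {i cell} → ClearCell (suc i) cell → uncurry weight cell ≡ 0
  clear⇒zero (z , refl , live) = refl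

  colors : ∀ {b} → color (proj₁ (b ! D)) ≡ just D → color (proj₁ (b ! P)) ≡ just P → Digits b →
           Colored (proj₁ ∘ (b !_))
  colors cD cP digits D     = cD
  colors cD cP digits P     = cP
  colors cD cP digits (G i) = proj₁ (digits i)

  round : ∀ {b} → Digits b → (∀ b′ → Digits b′ → suc (value (weights b)) ≤ value (weights b′) → Win b′) → Win b
  round {b} digits win = place-clear zero λ b₁ cellP same₁ →
    place D ask λ b₂ cD same₂ legal₂ → asked b₂ (subst (ClearCell zero) (sym (same₂ λ ())) cellP) cD
      (λ i → trans (same₂ λ ()) (same₁ (λ ()) λ ())) legal₂ _ refl
    where
    asked : ∀ b₂ → ClearCell zero (b₂ ! P) → proj₁ (b₂ ! D) ≡ ask → (∀ i → b₂ ! G i ≡ b ! G i) → LegalBoard b₂ →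
            ∀ r → proj₂ (b₂ ! D) ≡ r → Win b₂
    asked b₂ (z′ , cP , liveP) cD same legal r e = permitting r e
      (proj₁ (proj₂ (proj₂ legal) (colors {b₂} (cong color cD) (cong color cP) digits₂)) z′ cD cP liveP (proj₂ ∘ digits₂))
      where
      digits₂ : Digits b₂
      digits₂ i = subst (DigitCell i) (sym (same i)) (digits i)
      permitting : ∀ r → proj₂ (b₂ ! D) ≡ r → proj₂ (b₂ ! D) ≢ nothing × ¬ (∀ i → weights b₂ i ≡ Q) → Win b₂
      permitting nothing  e (live , _) = contradiction e live
      -- The lowest digit that is not maximal receives the carry.
      permitting (just z) e (_ , ¬max) with least-failure (λ i → weights b₂ i ℕ.≟ Q) ¬max
      ... | j , g≢Q , max with code-surjective (ℕ.≤∧≢⇒< (uncurry weight≤Q (b₂ ! G j)) g≢Q)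
      ... | α , β , next = place P (permit (bit z) j α) λ b₃ cP₃ same₃ legal₃ →
        let digits₃ : Digits b₃
            digits₃ i = subst (DigitCell i) (sym (same₃ λ ())) (digits₂ i)
            cD₃ = trans (cong proj₁ (same₃ λ ())) cD
            g₃ : ∀ i → weights b₃ i ≡ weights b₂ i
            g₃ i = cong (uncurry weight) (same₃ λ ())
        in permitted b₃ cP₃
          (proj₁ (proj₂ (proj₂ (proj₂ legal₃) (colors {b₃} (cong color cD₃) (cong color cP₃) digits₃)))
            z j α β cD₃ (trans (cong proj₂ (same₃ λ ())) e) cP₃ (proj₂ ∘ digits₃)
            (λ i i<j → trans (g₃ i) (max i i<j)) (trans next (cong suc (sym (g₃ j)))))
          (λ i → trans (same₃ λ ()) (same i))
        where
        next-b : code α β ≡ suc (weights b j)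
        next-b = trans next (cong (suc ∘ uncurry weight) (same j))
        -- `CommitRule` requires that `digit j α` is not there yet. The old code is smaller by one,
        -- so it belongs to a different element.
        ≢digit : ∀ {cell} → cell ≡ b ! G j → proj₁ cell ≢ digit j α
        ≢digit refl eq with lookup (proj₁ b) (G j) | lookup (proj₂ b) (G j) | digits j | eq | next-b
        ... | _ | nothing | _ , live | refl | _  = live refl
        ... | _ | just β′ | _        | refl | e′ = code-consecutive (s≤s (s≤s z≤n)) α β β′ e′
        permitted : ∀ b₃ → proj₁ (b₃ ! P) ≡ permit (bit z) j α → proj₂ (b₃ ! P) ≡ just β →
                    (∀ i → b₃ ! G i ≡ b ! G i) → Win b₃
        -- The resets touch only `D` and the digits below `j`, so the permit on `P` survives them.
        permitted b₃ cP wP same₃ = reset (toℕ j) (ℕ.<⇒≤ (toℕ<n j)) λ b₄ r →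
          place D commit λ b₅ cD₅ same₅ legal₅ → committed b₅
            (trans (same₅ λ ()) (kept r (λ ()) λ _ _ ()))
            cD₅
            (λ i i<j → subst (ClearCell (suc i)) (sym (same₅ λ ())) (cleared r i i<j))
            (λ i i≮j → trans (same₅ λ ()) (trans (kept r (λ ()) λ { _ i<j refl → i≮j i<j }) (same₃ i)))
            legal₅
          where
          committed : ∀ b₅ → b₅ ! P ≡ b₃ ! P → proj₁ (b₅ ! D) ≡ commit →
            (∀ i → i Fin.< j → ClearCell (suc i) (b₅ ! G i)) →
            (∀ i → ¬ (i Fin.< j) → b₅ ! G i ≡ b ! G i) → LegalBoard b₅ → Win b₅
          committed b₅ sameP cD₅ low high legal₅ = place (G j) (digit j α) λ b₆ cG₆ same₆ legal₆ → written b₆ cG₆ same₆ legal₆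
            where
            digits₅ : Digits b₅
            digits₅ i with i Fin.<? j
            ... | yes i<j = clear⇒digit (low i i<j)
            ... | no i≮j  = subst (DigitCell i) (sym (high i i≮j)) (digits i)
            cP₅ : proj₁ (b₅ ! P) ≡ permit (bit z) j α
            cP₅ = trans (cong proj₁ sameP) cP
            wP₅ : proj₂ (b₅ ! P) ≡ just β
            wP₅ = trans (cong proj₂ sameP) wP
            live : proj₂ (b₅ ! D) ≢ nothing
            live = proj₁ (proj₂ (proj₂ (proj₂ (proj₂ legal₅) (colors {b₅} (cong color cD₅) (cong color cP₅) digits₅))))
              (bit z) j α cD₅ cP₅ (λ wP′ → contradiction (trans (sym wP₅) wP′) λ ()) (proj₂ ∘ digits₅)
              (λ i i<j → clear⇒zero (low i i<j)) (≢digit (high j (ℕ.<-irrefl refl)))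
            written : ∀ b₆ → proj₁ (b₆ ! G j) ≡ digit j α → (∀ {Y} → Y ≢ G j → b₆ ! Y ≡ b₅ ! Y) → LegalBoard b₆ → Win b₆
            written b₆ cG₆ same₆ legal₆ = win b₆ digits₆
              (value-step≥ j (λ i _ → uncurry weight≤Q (b ! G i)) (ℕ.≤-reflexive (trans (sym next-b) (sym g₆j)))
                (λ i j<i → ℕ.≤-reflexive (cong (uncurry weight)
                  (sym (trans (same₆ λ { refl → ℕ.<-irrefl refl j<i }) (high i (ℕ.<-asym j<i)))))))
              where
              P₆ : b₆ ! P ≡ b₅ ! P
              P₆ = same₆ λ ()
              D₆ : b₆ ! D ≡ b₅ ! D
              D₆ = same₆ λ ()
              other : ∀ {i} → i ≢ j → b₆ ! G i ≡ b₅ ! G i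
              other i≢j = same₆ λ { refl → i≢j refl }
              colored₆ : ∀ i → color (proj₁ (b₆ ! G i)) ≡ just (G i)
              colored₆ i with i ≟ j
              ... | yes refl = cong color cG₆
              ... | no i≢j   = trans (cong (color ∘ proj₁) (other i≢j)) (proj₁ (digits₅ i))
              colored : Colored (proj₁ ∘ (b₆ !_))
              colored D     = cong color (trans (cong proj₁ D₆) cD₅)
              colored P     = cong color (trans (cong proj₁ P₆) cP₅)
              colored (G i) = colored₆ i
              wP₆ : proj₂ (b₆ ! P) ≡ just β
              wP₆ = trans (cong proj₂ P₆) wP₅
              wG₆ : proj₂ (b₆ ! G j) ≡ just β
              wG₆ = trans (proj₂ (proj₂ (proj₂ (proj₂ (proj₂ legal₆) colored))) (bit z) j α
                (trans (cong proj₁ D₆) cD₅) (subst (_≢ nothing) (sym (cong proj₂ D₆)) live)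
                (trans (cong proj₁ P₆) cP₅) (λ wP′ → contradiction (trans (sym wP₆) wP′) λ ())
                (λ i i≢j → subst (LiveCell) (sym (other i≢j)) (proj₂ (digits₅ i)))
                (λ i i<j → trans (cong (uncurry weight) (other λ { refl → ℕ.<-irrefl refl i<j })) (clear⇒zero (low i i<j)))
                cG₆) wP₆
              digits₆ : Digits b₆
              digits₆ i = colored₆ i , liveᵢ
                where
                liveᵢ : proj₂ (b₆ ! G i) ≢ nothing
                liveᵢ with i ≟ j
                ... | yes refl = λ e → contradiction (trans (sym wG₆) e) λ ()
                ... | no i≢j   = subst (LiveCell) (sym (other i≢j)) (proj₂ (digits₅ i))
              g₆j : weights b₆ j ≡ code α β
              g₆j = cong₂ weight cG₆ wG₆

  -- `fuel` cannot run out: each round raises the counter, which never exceeds `maximum d`.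
  count : ∀ fuel {b} → Digits b → maximum d < fuel + value (weights b) → Win b
  count zero       {b} digits lt = contradiction lt (ℕ.≤⇒≯ (value-mono {d} λ i → uncurry weight≤Q (b ! G i)))
  count (suc fuel) digits lt = round digits λ b′ digits′ more → count fuel digits′
    (ℕ.<-≤-trans lt (ℕ.≤-trans (ℕ.≤-reflexive (sym (ℕ.+-suc fuel _))) (ℕ.+-monoʳ-≤ fuel more)))

  wins : ∀ b → Win b
  wins b = reset d ℕ.≤-refl λ b′ r → count (suc (maximum d))
    (λ i → clear⇒digit (cleared r i (toℕ<n i))) (ℕ.m≤m+n _ _)

-- From Spoiler's win to a distinguishing sentence.

module _ {σ : Signature} {k : ℕ} where

  -- `zero ≐ zero` stands for truth, which the syntax lacks as a constant.
  ⋀ : ∀ {m} → (Fin m → ∃⁺L σ (suc k)) → ∃⁺L σ (suc k)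
  ⋀ {zero}  φ = zero ≐ zero
  ⋀ {suc m} φ = φ zero ∧ ⋀ (φ ∘ suc)

  module _ {n} {A : Structure σ n} where

    ⋀-intro : ∀ {s m} (φ : Fin m → ∃⁺L σ (suc k)) → (∀ i → A , s ⊩ φ i) → A , s ⊩ ⋀ φ
    ⋀-intro {m = zero}  φ sat = refl
    ⋀-intro {m = suc m} φ sat = sat zero , ⋀-intro (φ ∘ suc) (sat ∘ suc)

    ⋀-elim : ∀ {s m} (φ : Fin m → ∃⁺L σ (suc k)) → A , s ⊩ ⋀ φ → ∀ i → A , s ⊩ φ i
    ⋀-elim φ (sat , _) zero    = sat
    ⋀-elim φ (_ , sat) (suc i) = ⋀-elim (φ ∘ suc) sat i

module _ {σ : Signature} {k : ℕ} where

  exs : List (Fin k) → ∃⁺L σ k → ∃⁺L σ k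
  exs xs φ = List.foldr ex φ xs

  exs-bound : ∀ xs {φ : ∃⁺L σ k} {z} → z ∈ˡ xs → ¬ (z FreeIn exs xs φ)
  exs-bound (x ∷ xs) (here z≡x) (z≢x , _)  = z≢x z≡x
  exs-bound (x ∷ xs) (there z∈) (_ , free) = exs-bound xs z∈ free

  module _ {n} {A : Structure σ n} where

    exs-intro : ∀ xs {φ s t} → A , t ⊩ φ → (∀ z → z ∉ˡ xs → lookup s z ≡ lookup t z) → A , s ⊩ exs xs φ
    exs-intro []       {φ} sat eq = subst (λ s → A , s ⊩ φ) (sym (lookup-injective λ z → eq z λ ())) sat
    exs-intro (x ∷ xs) {φ} {s} {t} sat eq = lookup t x , exs-intro xs sat eq′
      where
      eq′ : ∀ z → z ∉ˡ xs → lookup (s [ x ]≔ lookup t x) z ≡ lookup t z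
      eq′ z z∉ with z ≟ x
      ... | yes refl = Vec.lookup∘update x s _
      ... | no z≢x   = trans (Vec.lookup∘update′ z≢x s _)
                         (eq z λ { (here z≡x) → z≢x z≡x ; (there z∈) → z∉ z∈ })

    exs-elim : ∀ xs {φ s} → A , s ⊩ exs xs φ → ∃[ t ] A , t ⊩ φ
    exs-elim []       {s = s} sat = s , sat
    exs-elim (x ∷ xs) (a , sat)   = exs-elim xs sat

module Separation (d M n : ℕ) (decode : Fin n → Elements.Elem d M)
  (encode : Elements.Elem d M → Fin n) (decode-encode : ∀ a → decode (encode a) ≡ a) where

  open Elements d M
  open Structures d M n decode encode decode-encode
  open Spoiler d M

  Separates : Vec (Fin n) k → Vec (Fin n) k → ∃⁺L σ k → Set
  Separates s y φ = 𝒜 , s ⊩ φ × ¬ (ℬ , y ⊩ φ)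

  -- An illegal answer is exposed by the relation belonging to the current tuple of `𝒜`. A move
  -- becomes a quantifier, followed by one conjunct for each possible answer in `ℬ`.
  win⇒separates : ∀ {b} → Win b → ∀ s y → b ≡ (map decode s , map read y) → ∃[ φ ] Separates s y φ
  win⇒separates (illegal ¬legal) s y refl = rel R (allFin k) ,
    fromWitness (inj₁ (trans (cong (map decode) (Vec.map-lookup-allFin s)) (sym c≡))) ,
    λ t → ¬legal (subst₂ LegalVec c≡ (cong (map read) (Vec.map-lookup-allFin y)) (toWitness t))
    where
    R : Relation σ
    R = relation-of (map decode s)
    c≡ : pattern-of R ≡ map decode s
    c≡ = pattern-relation (map decode s)
  win⇒separates (move X a win) s y refl = ex X (⋀ φ) ,
    (encode a , ⋀-intro {A = 𝒜} φ (λ b → proj₁ (proj₂ (next b)))) ,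
    λ (b , sat) → proj₂ (proj₂ (next b)) (⋀-elim {A = ℬ} φ sat b)
    where
    next : ∀ b → ∃[ φ ] Separates (s [ X ]≔ encode a) (y [ X ]≔ b) φ
    next b = win⇒separates (win (read b)) (s [ X ]≔ encode a) (y [ X ]≔ b) (cong₂ _,_
      (sym (trans (Vec.map-[]≔ decode s X) (cong (map decode s [ X ]≔_) (decode-encode a))))
      (sym (Vec.map-[]≔ read y X)))
    φ : Fin n → ∃⁺L σ k
    φ b = proj₁ (next b)

  -- Spoiler wins from every board. The conjunction over all assignments in `ℬ` therefore holds at
  -- `s` but nowhere in `ℬ`, and quantifying all variables makes it a sentence.
  separation : Σ[ φ ∈ ∃⁺L σ k ] (Sentence φ × Distinguishes φ 𝒜 ℬ)
  separation = exs xs χ , (λ z → exs-bound xs {χ} (∈-allFin z)) , λ agree →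
    let t , sat = exs-elim {A = ℬ} xs {χ} {s} (Equivalence.to agree holds s) in refutes t sat
    where
    xs : List (Fin k)
    xs = List.allFin k
    s : Vec (Fin n) k
    s = tabulate λ _ → encode ask
    assignment : Fin (n ^ k) → Vec (Fin n) k
    assignment = tabulate ∘ finToFun
    separating : ∀ y → ∃[ φ ] Separates s y φ
    separating y = win⇒separates (wins _) s y refl
    φ : Fin (n ^ k) → ∃⁺L σ k
    φ = proj₁ ∘ separating ∘ assignment
    χ : ∃⁺L σ k
    χ = ⋀ φ
    holds : 𝒜 ⊨ exs xs χ
    holds s′ = exs-intro {A = 𝒜} xs {χ} {s′} {s} (⋀-intro {A = 𝒜} φ (λ i → proj₁ (proj₂ (separating (assignment i)))))
                 (λ z z∉ → contradiction (∈-allFin z) z∉)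
    refutes : ∀ t → ¬ (ℬ , t ⊩ χ)
    refutes t sat = proj₂ (proj₂ (separating (assignment i)))
      (subst (λ t → ℬ , t ⊩ φ i) (sym (trans (Vec.tabulate-cong (finToFun-funToFin (lookup t))) (Vec.tabulate∘lookup t)))
        (⋀-elim {A = ℬ} φ sat i))
      where
      i : Fin (n ^ k)
      i = funToFin (lookup t)

-- Size estimates and the choice of constants.

private
  -- For `ε = 1 / (q + 1)`: if `m` were at least `2 ^ L`, its power `suc q` would be at least
  -- `2 ^ (suc q * L)`, and `X` is no larger than that exponent.
  bound : ∀ q {m L X} → X ≤ q * L → m ^ suc q < 2 ^ (1 * X) → m < 2 ^ L
  bound q {m} {L} {X} X≤ lt with m ℕ.<? 2 ^ L
  ... | yes m< = m<
  ... | no m≮  = contradiction lt (ℕ.≤⇒≯ (begin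
    2 ^ (1 * X)     ≤⟨ ℕ.^-monoʳ-≤ 2 (ℕ.≤-trans (ℕ.≤-reflexive (ℕ.*-identityˡ X)) (ℕ.≤-trans X≤
                         (ℕ.≤-trans (ℕ.m≤n+m (q * L) L) (ℕ.≤-reflexive (ℕ.*-comm (suc q) L))))) ⟩
    2 ^ (L * suc q) ≡⟨ ℕ.^-*-assoc 2 L (suc q) ⟨
    (2 ^ L) ^ suc q ≤⟨ ℕ.^-monoˡ-≤ (suc q) (ℕ.≮⇒≥ m≮) ⟩
    m ^ suc q       ∎))
    where open ℕ.≤-Reasoning

  size≤ : ∀ d M → Elements.size d M ≤ Elements.N d M * (6 + 5 * d)
  size≤ d M = ℕ.≤-trans (ℕ.+-monoʳ-≤ (suc N) (ℕ.+-monoˡ-≤ _ (ℕ.m≤m*n (suc d) N)))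
    -- Since `2 + d + M` is `N ∸ 1`, this summand fills up the three constant terms to `3 * N`.
    (ℕ.≤-trans (ℕ.m≤m+n _ (3 * (2 + d + M))) (ℕ.≤-reflexive (total d (2 + d + M))))
    where
    N = Elements.N d M
    total : ∀ d m → let N = suc m in
      suc N + (suc d * N + (1 + (1 + (suc d * N + (2 * (d * N) + d * N))))) + 3 * m ≡ N * (6 + 5 * d)
    total = solve-∀

  exponent : ∀ d → 2 * (2 + d) ∸ 4 ≡ 2 * d
  exponent d = trans (cong (_∸ 4) (ℕ.*-distribˡ-+ 2 2 d)) (ℕ.m+n∸m≡n 4 (2 * d))

  -- `m + M` is the quotient of `n` by `C`. The lower bound on `n` makes the quotient at least `m`,
  -- and the remainder is below `C`.
  divide : ∀ c {n} m → let C = suc c in C * m < n →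
           ∃[ M ] (m + M) * C ≤ n × n ≤ C * (m + M) + C
  divide c {n} m lt = n / C ∸ m , subst (λ x → x * C ≤ n) (sym quotient) (m/n*n≤m n C) ,
    subst (λ x → n ≤ C * x + C) (sym quotient) (begin
      n                    ≡⟨ m≡m%n+[m/n]*n n C ⟩
      n % C + n / C * C    ≤⟨ ℕ.+-monoˡ-≤ _ (ℕ.<⇒≤ (m%n<n n C)) ⟩
      C + n / C * C        ≡⟨ ℕ.+-comm C _ ⟩
      n / C * C + C        ≡⟨ cong (_+ C) (ℕ.*-comm (n / C) C) ⟩
      C * (n / C) + C      ∎)
    where
    open ℕ.≤-Reasoning
    C = suc c
    quotient : m + (n / C ∸ m) ≡ n / C
    quotient = ℕ.m+[n∸m]≡n (subst (_≤ n / C) (m*n/n≡m m C)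
      (/-mono-≤ {o = C} {p = C} (ℕ.<⇒≤ (subst (_< n) (ℕ.*-comm C m) lt)) ℕ.≤-refl))

  product-power : ∀ m n o → (m * n) ^ o ≡ m ^ o * n ^ o
  product-power m n zero    = refl
  product-power m n (suc o) =
    trans (cong (m * n *_) (product-power m n o)) (ℕ.[m*n]*[o*p]≡[m*o]*[n*p] m n (m ^ o) (n ^ o))

  -- The counter reaches at least `(N * N) ^ d = N ^ (2 * d)`, and `n` is at most a constant times
  -- `N`.
  power≤ : ∀ C N {d n} → 1 ≤ d → n ≤ (2 * C) * N →
           n ^ (2 * d) ≤ (2 * C) ^ (2 * d) * Counter.maximum (N * N) d
  power≤ C N {d} {n} 1≤d n≤ = begin
    n ^ (2 * d)                         ≤⟨ ℕ.^-monoˡ-≤ (2 * d) n≤ ⟩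
    (2 * C * N) ^ (2 * d)               ≡⟨ product-power (2 * C) N (2 * d) ⟩
    (2 * C) ^ (2 * d) * N ^ (2 * d)     ≡⟨ cong ((2 * C) ^ (2 * d) *_) (trans (sym (ℕ.^-*-assoc N 2 d))
                                             (cong (λ x → (N * x) ^ d) (ℕ.*-identityʳ N))) ⟩
    (2 * C) ^ (2 * d) * (N * N) ^ d     ≤⟨ ℕ.*-monoʳ-≤ ((2 * C) ^ (2 * d)) (Counter.maximum≥ (N * N) 1≤d) ⟩
    (2 * C) ^ (2 * d) * Counter.maximum (N * N) d ∎
    where open ℕ.≤-Reasoning

  twice : ∀ C N → C * N + C * N ≡ 2 * C * N
  twice = solve-∀

-- Assembling the theorem.

IndistinguishablePair : (k n : ℕ) → (ℕ → Set) → Set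
IndistinguishablePair k n Few = Σ[ σ ∈ Signature ] ((k -ary) σ ×
  (Σ[ A ∈ Structure σ n ] Σ[ B ∈ Structure σ n ]
    ((Σ[ φ ∈ ∃⁺L σ k ] (Sentence φ × Distinguishes φ A B)) ×
     (∀ (φ : ∃⁺L σ k) → Sentence φ → Few (#quantifiers φ) → AgreeOn A B φ))))

counter-pair : ∀ d M {n} → Elements.size d M ≤ n →
               IndistinguishablePair (2 + d) n (_< 2 ^ Counter.maximum (Elements.Q d M) d)
counter-pair d M {n} size≤n = σ , (λ _ → ℕ.≤-refl) , 𝒜 , ℬ , separation , agree
  where
  open Elements.Coding d M n size≤n
  open Structures d M n decode encode decode-encode using (σ; 𝒜; ℬ)
  open Separation d M n decode encode decode-encode using (separation)
  open Play d M n decode encode decode-encode using (agree)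

relax : ∀ {k n} {Few Fewer : ℕ → Set} → (∀ {m} → Fewer m → Few m) →
        IndistinguishablePair k n Few → IndistinguishablePair k n Fewer
relax fewer (σ , ary , A , B , separation , agree) =
  σ , ary , A , B , separation , λ φ sen few → agree φ sen (fewer few)

exponential-pairs : ∀ d → 1 ≤ d → Σ[ ε ∈ ℚ ] (ε >ℚ 0ℚ × (Σ[ n₀ ∈ ℕ ] (∀ n → n > n₀ →
                    IndistinguishablePair (2 + d) n (_<2^[ ε · n ^ (2 * (2 + d) ∸ 4) ]))))
-- `mkℚ` takes the denominator minus one, so `ε` is `1 / (q + 1)`. Beyond the threshold
-- `C * (3 + d)` the quotient of `n` by `C` is at least `3 + d`, as `N = 3 + d + M` demands.
exponential-pairs d 1≤d = mkℚ (+ 1) q (1-coprimeTo (suc q)) , *<* (+<+ (s≤s z≤n)) , C * (3 + d) , pairs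
  where
  C = 6 + 5 * d
  q = (2 * C) ^ (2 * d)
  Few : ℕ → ℕ → Set
  Few n m = m ^ suc q < 2 ^ (1 * n ^ (2 * (2 + d) ∸ 4))
  pairs : ∀ n → n > C * (3 + d) → IndistinguishablePair (2 + d) n (Few n)
  pairs n n> =
    relax {Fewer = Few n} (λ {m} few → bound q {m} (power≤ C N 1≤d n≤2CN)
            (subst (λ e → m ^ suc q < 2 ^ (1 * n ^ e)) (exponent d) few))
          (counter-pair d M (ℕ.≤-trans (size≤ d M) (proj₁ (proj₂ quotient))))
    where
    quotient : ∃[ M ] (3 + d + M) * C ≤ n × n ≤ C * (3 + d + M) + C
    quotient = divide (5 + 5 * d) (3 + d) n>
    M N : ℕ
    M = proj₁ quotient
    N = Elements.N d M
    n≤2CN : n ≤ 2 * C * N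
    n≤2CN = begin
      n             ≤⟨ proj₂ (proj₂ quotient) ⟩
      C * N + C     ≤⟨ ℕ.+-monoʳ-≤ (C * N) (ℕ.m≤m*n C N) ⟩
      C * N + C * N ≡⟨ twice C N ⟩
      2 * C * N     ∎
      where open ℕ.≤-Reasoning

theorem3 : ∀ (k : ℕ) → k ≥ 4 →
    Σ[ ε ∈ ℚ ] (ε >ℚ 0ℚ × (Σ[ n₀ ∈ ℕ ] (∀ (n : ℕ) → n > n₀ →
    Σ[ σ ∈ Signature ] ((k -ary) σ ×
    (Σ[ A ∈ Structure σ n ] Σ[ B ∈ Structure σ n ]
    ((Σ[ φ ∈ ∃⁺L σ k ] (Sentence φ × Distinguishes φ A B)) ×
    (∀ (φ : ∃⁺L σ k) → Sentence φ →
    #quantifiers φ <2^[ ε · n ^ (2 * k ∸ 4) ] →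
    AgreeOn A B φ)))))))
theorem3 k@(suc (suc d)) (s≤s (s≤s 2≤d)) = exponential-pairs d (ℕ.<⇒≤ 2≤d)
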